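{- Let $k_1,k_2,k_3\in\mathbb{Z}_{\ge0}$ and let $(P,Q,R)$ be a $(k_1,k_2,k_3)$-CGC triple associated with the non-labeled cluster $(a,b,c)$, and assume $|b|>\max\{|a|,|c|\}$. Then there exist a unique $f\in\mathbb{Z}[x_1^{\pm1},x_2^{\pm1},x_3^{\pm1}]$, a unique $\sigma\in\mathfrak{S}_3$ and a unique vertex $v$ of $\mathrm{CGC}\mathbb{T}(k_1,k_2,k_3,\sigma,f)$ such that $v=(P,Q,R)$.
   Context: Fix $k_1,k_2,k_3\in\mathbb{Z}_{\ge0}$, indeterminates $x_1,x_2,x_3$, and write $\mathbb{Z}[x^{\pm}]=\mathbb{Z}[x_1^{\pm1},x_2^{\pm1},x_3^{\pm1}]$. Mutations: $\mu_1(a,b,c)=(\frac{b^2+k_1bc+c^2}{a},b,c)$, $\mu_2(a,b,c)=(a,\frac{a^2+k_2ac+c^2}{b},c)$, $\mu_3(a,b,c)=(a,b,\frac{a^2+k_3ab+b^2}{c})$. Labeled clusters of $\mathcal{A}(k_1,k_2,k_3)$: triples obtained from $(x_1,x_2,x_3)$ by finitely many mutations; non-labeled clusters: permutations of labeled clusters; cluster variables: entries of labeled clusters. A cluster variable $y$ occurs in a unique position $i$ among labeled clusters, and its parity is $k_y:=k_i$. For a Laurent polynomial $a$, $|a|$ is its value at $x_1=x_2=x_3=1$. $\mathscr{M}=\frac{x_1^2+x_2^2+x_3^2+k_1x_2x_3+k_2x_1x_3+k_3x_1x_2}{x_1x_2x_3}$. For a $2\times 2$ matrix $P=(p_{ij})$,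 $S_P=\begin{bmatrix}\mathscr{M}p_{12}-\mathrm{tr}P&0\\(\mathscr{M}p_{12}-\mathrm{tr}P)\mathscr{M}&\mathscr{M}p_{12}-\mathrm{tr}P\end{bmatrix}$. A CGC matrix is $P\in SL(2,\mathbb{Z}[x^\pm])$ with $p_{12}$ a cluster variable and $\mathrm{tr}P=\mathscr{M}p_{12}-k_{p_{12}}$; a CGC triple is a triple $(P,Q,R)$ of CGC matrices with $Q=PR-S_Q$ and $(p_{12},q_{12},r_{12})$ a non-labeled cluster (the triple is associated with it). For $\sigma\in\mathfrak{S}_3$ and $f\in\mathbb{Z}[x^\pm]$ write $y_i=x_{\sigma(i)}$, $\kappa_i=k_{\sigma(i)}$ and define (the $(2,1)$-entries $*$ being determined by determinant $1$): $P_\sigma(f)=\begin{bmatrix}f&y_1\\ *&\frac{ -fy_2y_3+\kappa_2y_1y_3+\kappa_3y_1y_2+y_1^2+y_2^2+y_3^2}{y_2y_3}\end{bmatrix}$, $Q_\sigma(f)=\begin{bmatrix}\frac{fy_2+\kappa_1y_2+y_3}{y_1}&y_2\\ *&\frac{ -fy_2y_3+\kappa_3y_1y_2+y_1^2+y_2^2}{y_1y_3}\end{bmatrix}$, $R_\sigma(f)=\begin{bmatrix}\frac{fy_2y_3+\kappa_1y_2y_3+\kappa_2y_1y_3+y_1^2+y_3^2}{y_1y_2}&y_3\\ *&\frac{ -fy_2y_3+y_2^2}{y_1y_2}\end{bmatrix}$. The cluster generalized Cohn tree $\mathrm{CGC}\mathbb{T}(k_1,k_2,k_3,\sigma,f)$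 is the rooted planar binary tree whose root is $(P_\tau(f),\,P_\tau(f)Q_\tau(f)-S_{R_\tau(f)},\,Q_\tau(f))$ with $\tau=\sigma\circ(2\ 3)$ (permutations composed right to left), and in which each vertex $(P,Q,R)$ has left child $(P,PQ-S_R,Q)$ and right child $(Q,QR-S_P,R)$. -}

module Defs where

open import Data.Nat using (ℕ)
open import Data.Integer as ℤ using (ℤ; +_; -[1+_]; 0ℤ; 1ℤ; -1ℤ)
import Data.Integer.Properties as ℤP
open import Data.Fin using (Fin; zero; suc)
open import Data.Product using (Σ; ∃; _×_; _,_; proj₁; proj₂)
open import Data.Product.Properties using (≡-dec)
open import Data.List using (List; []; _∷_; _++_; map; concatMap; foldr)
open import Data.Bool using (if_then_else_)
open import Relation.Nullary.Decidable using (⌊_⌋)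
open import Relation.Binary.PropositionalEquality using (_≡_)

-- Laurent polynomials ℤ[x₁^±1, x₂^±1, x₃^±1]
-- A Laurent polynomial is represented by a finite list of terms
-- (coefficient , exponent vector); two representations are identified
-- (setoid equality _≈_) iff all their coefficients agree.

Exp : Set
Exp = ℤ × ℤ × ℤ

_≟ₑ_ : (e e' : Exp) → Relation.Nullary.Decidable.Dec (e ≡ e')
_≟ₑ_ = ≡-dec ℤ._≟_ (≡-dec ℤ._≟_ ℤ._≟_)
  where import Relation.Nullary.Decidable

_+ₑ_ : Exp → Exp → Exp
(a , b , c) +ₑ (a' , b' , c') = (a ℤ.+ a') , (b ℤ.+ b') , (c ℤ.+ c')

LP : Set
LP = List (ℤ × Exp)

coeff : LP → Exp → ℤ
coeff [] e = 0ℤ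
coeff ((c , e') ∷ p) e = (if ⌊ e ≟ₑ e' ⌋ then c else 0ℤ) ℤ.+ coeff p e

infix 4 _≈_
_≈_ : LP → LP → Set
p ≈ q = ∀ e → coeff p e ≡ coeff q e

infixl 6 _⊕_ _⊖_
infixl 7 _⊗_

_⊕_ : LP → LP → LP
p ⊕ q = p ++ q

⊝_ : LP → LP
⊝ p = map (λ t → ℤ.- proj₁ t , proj₂ t) p

_⊖_ : LP → LP → LP
p ⊖ q = p ⊕ (⊝ q)

_⊗_ : LP → LP → LP
p ⊗ q = concatMap (λ t → map (λ s → proj₁ t ℤ.* proj₁ s , proj₂ t +ₑ proj₂ s) q) p

⟨_⟩ : ℤ → LP
⟨ z ⟩ = (z , 0ℤ , 0ℤ , 0ℤ) ∷ []

⟪_⟫ : ℕ → LP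
⟪ n ⟫ = ⟨ + n ⟩

one : LP
one = ⟨ 1ℤ ⟩

unitExp : ℤ → Fin 3 → Exp
unitExp z zero = z , 0ℤ , 0ℤ
unitExp z (suc zero) = 0ℤ , z , 0ℤ
unitExp z (suc (suc zero)) = 0ℤ , 0ℤ , z

X : Fin 3 → LP
X i = (1ℤ , unitExp 1ℤ i) ∷ []

Xinv : Fin 3 → LP
Xinv i = (1ℤ , unitExp -1ℤ i) ∷ []

x₁ x₂ x₃ : LP
x₁ = X zero
x₂ = X (suc zero)
x₃ = X (suc (suc zero))

-- |a| : value at x₁ = x₂ = x₃ = 1 (sum of all coefficients)
∣_∣ₗ : LP → ℤ
∣ p ∣ₗ = foldr (λ t acc → proj₁ t ℤ.+ acc) 0ℤ p

K : Set
K = ℕ × ℕ × ℕ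

kAt : K → Fin 3 → ℕ
kAt (k₁ , k₂ , k₃) zero = k₁
kAt (k₁ , k₂ , k₃) (suc zero) = k₂
kAt (k₁ , k₂ , k₃) (suc (suc zero)) = k₃

Triple : Set
Triple = LP × LP × LP

get : Triple → Fin 3 → LP
get (a , b , c) zero = a
get (a , b , c) (suc zero) = b
get (a , b , c) (suc (suc zero)) = c

_≈₃_ : Triple → Triple → Set
(a , b , c) ≈₃ (a' , b' , c') = (a ≈ a') × (b ≈ b') × (c ≈ c')

-- Labeled clusters of A(k₁,k₂,k₃): the smallest (≈-closed) set of triples
-- containing (x₁,x₂,x₃) and closed under μ₁, μ₂, μ₃.  The mutation
-- μ₁(a,b,c) = ((b²+k₁bc+c²)/a, b, c) is expressed division-free:
-- a' is the (unique, ℤ[x^±] being a domain) element with a'·a = b²+k₁bc+c².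
data LabeledCluster (k : K) : Triple → Set where
  initial : LabeledCluster k (x₁ , x₂ , x₃)
  mut₁ : ∀ {a b c a'} → LabeledCluster k (a , b , c) →
         a' ⊗ a ≈ b ⊗ b ⊕ ⟪ kAt k zero ⟫ ⊗ b ⊗ c ⊕ c ⊗ c →
         LabeledCluster k (a' , b , c)
  mut₂ : ∀ {a b c b'} → LabeledCluster k (a , b , c) →
         b' ⊗ b ≈ a ⊗ a ⊕ ⟪ kAt k (suc zero) ⟫ ⊗ a ⊗ c ⊕ c ⊗ c →
         LabeledCluster k (a , b' , c)
  mut₃ : ∀ {a b c c'} → LabeledCluster k (a , b , c) →
         c' ⊗ c ≈ a ⊗ a ⊕ ⟪ kAt k (suc (suc zero)) ⟫ ⊗ a ⊗ b ⊕ b ⊗ b →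
         LabeledCluster k (a , b , c')
  resp : ∀ {t s} → LabeledCluster k t → t ≈₃ s → LabeledCluster k s

data S₃ : Set where
  id t12 t13 t23 c123 c132 : S₃

apply : S₃ → Fin 3 → Fin 3
apply id i = i
apply t12 zero = suc zero
apply t12 (suc zero) = zero
apply t12 (suc (suc zero)) = suc (suc zero)
apply t13 zero = suc (suc zero)
apply t13 (suc zero) = suc zero
apply t13 (suc (suc zero)) = zero
apply t23 zero = zero
apply t23 (suc zero) = suc (suc zero)
apply t23 (suc (suc zero)) = suc zero
apply c123 zero = suc zero
apply c123 (suc zero) = suc (suc zero)
apply c123 (suc (suc zero)) = zero
apply c132 zero = suc (suc zero)
apply c132 (suc zero) = zero
apply c132 (suc (suc zero)) = suc zero

permute : S₃ → Triple → Triple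
permute σ t = get t (apply σ zero) , get t (apply σ (suc zero)) , get t (apply σ (suc (suc zero)))

NonLabeledCluster : K → Triple → Set
NonLabeledCluster k t = Σ S₃ λ σ → LabeledCluster k (permute σ t)

ClusterVarAt : K → Fin 3 → LP → Set
ClusterVarAt k i y = Σ Triple λ t → LabeledCluster k t × (get t i ≈ y)

record M₂ : Set where
  constructor mat
  field
    m₁₁ m₁₂ m₂₁ m₂₂ : LP
open M₂ public

_·_ : M₂ → M₂ → M₂
A · B = mat (m₁₁ A ⊗ m₁₁ B ⊕ m₁₂ A ⊗ m₂₁ B) (m₁₁ A ⊗ m₁₂ B ⊕ m₁₂ A ⊗ m₂₂ B)
            (m₂₁ A ⊗ m₁₁ B ⊕ m₂₂ A ⊗ m₂₁ B) (m₂₁ A ⊗ m₁₂ B ⊕ m₂₂ A ⊗ m₂₂ B)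

_−ₘ_ : M₂ → M₂ → M₂
A −ₘ B = mat (m₁₁ A ⊖ m₁₁ B) (m₁₂ A ⊖ m₁₂ B) (m₂₁ A ⊖ m₂₁ B) (m₂₂ A ⊖ m₂₂ B)

tr : M₂ → LP
tr A = m₁₁ A ⊕ m₂₂ A

det : M₂ → LP
det A = m₁₁ A ⊗ m₂₂ A ⊖ m₁₂ A ⊗ m₂₁ A

_≈ₘ_ : M₂ → M₂ → Set
A ≈ₘ B = (m₁₁ A ≈ m₁₁ B) × (m₁₂ A ≈ m₁₂ B) × (m₂₁ A ≈ m₂₁ B) × (m₂₂ A ≈ m₂₂ B)

𝓜 : K → LP
𝓜 k = (x₁ ⊗ x₁ ⊕ x₂ ⊗ x₂ ⊕ x₃ ⊗ x₃ ⊕ ⟪ kAt k zero ⟫ ⊗ x₂ ⊗ x₃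
        ⊕ ⟪ kAt k (suc zero) ⟫ ⊗ x₁ ⊗ x₃ ⊕ ⟪ kAt k (suc (suc zero)) ⟫ ⊗ x₁ ⊗ x₂)
      ⊗ Xinv zero ⊗ Xinv (suc zero) ⊗ Xinv (suc (suc zero))

S : K → M₂ → M₂
S k P = mat s ⟨ 0ℤ ⟩ (s ⊗ 𝓜 k) s
  where s = 𝓜 k ⊗ m₁₂ P ⊖ tr P

IsCGCMatrix : K → M₂ → Set
IsCGCMatrix k P = (det P ≈ one) ×
  Σ (Fin 3) λ i → ClusterVarAt k i (m₁₂ P) × (tr P ≈ 𝓜 k ⊗ m₁₂ P ⊖ ⟪ kAt k i ⟫)

MTriple : Set
MTriple = M₂ × M₂ × M₂

_≈ₜ_ : MTriple → MTriple → Set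
(P , Q , R) ≈ₜ (P' , Q' , R') = (P ≈ₘ P') × (Q ≈ₘ Q') × (R ≈ₘ R')

IsCGCTriple : K → MTriple → Set
IsCGCTriple k (P , Q , R) =
  IsCGCMatrix k P × IsCGCMatrix k Q × IsCGCMatrix k R ×
  (Q ≈ₘ ((P · R) −ₘ S k Q)) ×
  NonLabeledCluster k (m₁₂ P , m₁₂ Q , m₁₂ R)

-- The matrices P_π(f), Q_π(f), R_π(f) for a permutation given as a map
-- π : Fin 3 → Fin 3 (y_i = x_{π(i)}, κ_i = k_{π(i)}).  The (2,1)-entry is
-- (p₁₁p₂₂ − 1)/p₁₂, p₁₂ being a variable.

module _ (k : K) (π : Fin 3 → Fin 3) (f : LP) where
  private
    y₁ = X (π zero)
    y₂ = X (π (suc zero))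
    y₃ = X (π (suc (suc zero)))
    y₁⁻¹ = Xinv (π zero)
    y₂⁻¹ = Xinv (π (suc zero))
    y₃⁻¹ = Xinv (π (suc (suc zero)))
    κ₁ = ⟪ kAt k (π zero) ⟫
    κ₂ = ⟪ kAt k (π (suc zero)) ⟫
    κ₃ = ⟪ kAt k (π (suc (suc zero))) ⟫


  Pmat : M₂
  Pmat = mat p₁₁ y₁ ((p₁₁ ⊗ p₂₂ ⊖ one) ⊗ y₁⁻¹) p₂₂
    where
    p₁₁ = f
    p₂₂ = (⊝ (f ⊗ y₂ ⊗ y₃) ⊕ κ₂ ⊗ y₁ ⊗ y₃ ⊕ κ₃ ⊗ y₁ ⊗ y₂ ⊕ y₁ ⊗ y₁ ⊕ y₂ ⊗ y₂ ⊕ y₃ ⊗ y₃)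
          ⊗ y₂⁻¹ ⊗ y₃⁻¹

  Qmat : M₂
  Qmat = mat q₁₁ y₂ ((q₁₁ ⊗ q₂₂ ⊖ one) ⊗ y₂⁻¹) q₂₂
    where
    q₁₁ = (f ⊗ y₂ ⊕ κ₁ ⊗ y₂ ⊕ y₃) ⊗ y₁⁻¹
    q₂₂ = (⊝ (f ⊗ y₂ ⊗ y₃) ⊕ κ₃ ⊗ y₁ ⊗ y₂ ⊕ y₁ ⊗ y₁ ⊕ y₂ ⊗ y₂) ⊗ y₁⁻¹ ⊗ y₃⁻¹

  Rmat : M₂
  Rmat = mat r₁₁ y₃ ((r₁₁ ⊗ r₂₂ ⊖ one) ⊗ y₃⁻¹) r₂₂
    where
    r₁₁ = (f ⊗ y₂ ⊗ y₃ ⊕ κ₁ ⊗ y₂ ⊗ y₃ ⊕ κ₂ ⊗ y₁ ⊗ y₃ ⊕ y₁ ⊗ y₁ ⊕ y₃ ⊗ y₃)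
          ⊗ y₁⁻¹ ⊗ y₂⁻¹
    r₂₂ = (⊝ (f ⊗ y₂ ⊗ y₃) ⊕ y₂ ⊗ y₂) ⊗ y₁⁻¹ ⊗ y₂⁻¹

-- The cluster generalized Cohn tree CGC𝕋(k₁,k₂,k₃,σ,f).
-- Vertices are addressed by paths from the root (lists of directions).

data Dir : Set where
  L R : Dir

leftChild rightChild : K → MTriple → MTriple
leftChild k (P , Q , R′) = P , ((P · Q) −ₘ S k R′) , Q
rightChild k (P , Q , R′) = Q , ((Q · R′) −ₘ S k P) , R′

τ : S₃ → Fin 3 → Fin 3
τ σ i = apply σ (apply t23 i)

root : K → S₃ → LP → MTriple
root k σ f = Pmat k (τ σ) f , ((Pmat k (τ σ) f · Qmat k (τ σ) f) −ₘ S k (Rmat k (τ σ) f)) ,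
             Qmat k (τ σ) f

walk : K → MTriple → List Dir → MTriple
walk k t [] = t
walk k t (L ∷ ds) = walk k (leftChild k t) ds
walk k t (R ∷ ds) = walk k (rightChild k t) ds

vertex : K → S₃ → LP → List Dir → MTriple
vertex k σ f ds = walk k (root k σ f) ds

{-# OPTIONS --safe #-}
module Submission where

-- The (1,2)-entries of a CGC triple form a cluster, hence solve the Markov-type equation, whose two
-- roots in the middle variable are exchanged by mutation. The matrices follow the cluster: with
-- N = [[1,0],[M,1]] and P of determinant 1, the equation Q = P R − s N recovers R from P and Q, and
-- Cayley–Hamilton turns the trace and determinant conditions for (P, Q, R) into those for its parent
-- and its children. Values at x₁ = x₂ = x₃ = 1 grow strictly away from the initial cluster, so
-- comparing |p₁₂| with |r₁₂| tells whether a vertex is a left child, a right child or the root, and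
-- iterating descends to a root, where f = p₁₁ and the positions of the initial variables give σ.
-- That the parity k_y of a cluster variable is well defined is seen on its lexicographically leading
-- exponent: an exchange replaces this exponent e by 2m − e, so mod 2 it depends only on the position.

open import Defs
open import Algebra.Bundles using (CommutativeRing)
import Algebra.Solver.Ring as RingSolver
open import Algebra.Solver.Ring.AlmostCommutativeRing using (fromCommutativeRing; _-Raw-AlmostCommutative⟶_)
open import Data.Bool using (if_then_else_)
open import Data.Empty using (⊥-elim)
open import Data.Fin using (Fin; zero; suc)
open import Data.Fin.Properties using (_≟_)
open import Data.Integer using (_<_; _⊔_)
open import Data.Integer as ℤ using (ℤ; +_; 0ℤ; 1ℤ; -1ℤ)
import Data.Integer.Properties as ℤP
import Data.Integer.Solver as ℤSolver
open import Data.List using (List; []; _∷_; map; length; foldr; foldl; reverse)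
open import Data.List.Properties using (++-assoc; reverse-foldr; reverse-involutive)
open import Data.List.Relation.Unary.All as All using (All; []; _∷_)
open import Data.Maybe using (Maybe; just; nothing)
open import Data.Nat using (ℕ)
open import Data.Nat as ℕ using (suc)
import Data.Nat.Properties as ℕP
open import Data.Product using (Σ; _×_; _,_; proj₁; proj₂; map₂)
open import Data.Sum using (_⊎_; inj₁; inj₂)
open import Level using (0ℓ)
open import Relation.Binary.Definitions using (tri<; tri≈; tri>)
open import Relation.Binary.PropositionalEquality using (_≡_; _≢_; refl; sym; trans; cong; cong₂; subst; subst₂; module ≡-Reasoning)
open import Relation.Nullary using (¬_; yes; no)
open import Relation.Nullary.Decidable using (⌊_⌋)

-- The root of the tree is the left child of (P_τ(f), Q_τ(f), R_τ(f)), whose (1,2)-entries are the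
-- initial variables. The transposition in τ = σ ∘ (2 3) puts x_σ(2), the variable exchanged at the
-- root, in third place, so the outer entries of the root are x_σ(1) and x_σ(3), in the order of σ.
-- The parameter f is free because an ordered cluster leaves a triple over it one degree of freedom:
-- once p₁₁ is given, trace and determinant fix P, the (1,2)-entry of P R fixes r₂₂, and with it R
-- and then Q. The descent can therefore follow the cluster alone, and p₁₁ is inspected only at its
-- end. Positivity enters in two independent ways. Values at 1 steer the descent and show that
-- entries are nonzero, so that divisions become cancellations in a domain. Positive leading
-- coefficients keep the top terms of an exchange polynomial from cancelling, without which the
-- parity argument would fail.

private module Z = ℤSolver.+-*-Solver


-- Laurent polynomials through their linear functionals

-- All linear functionals on Laurent polynomials arise in this way, so ≈ is equality under every pairing.
pair : (Exp → ℤ) → LP → ℤ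
pair g [] = 0ℤ
pair g ((c , e) ∷ p) = c ℤ.* g e ℤ.+ pair g p

δ : Exp → Exp → ℤ
δ e x = if ⌊ e ≟ₑ x ⌋ then 1ℤ else 0ℤ

δ-diag : ∀ e → δ e e ≡ 1ℤ
δ-diag e with e ≟ₑ e
... | yes _ = refl
... | no e≢e = ⊥-elim (e≢e refl)

δ-off : ∀ {e x} → e ≢ x → δ e x ≡ 0ℤ
δ-off {e} {x} e≢x with e ≟ₑ x
... | yes e≡x = ⊥-elim (e≢x e≡x)
... | no _ = refl

coeff≡pair : ∀ p e → coeff p e ≡ pair (δ e) p
coeff≡pair [] e = refl
coeff≡pair ((c , x) ∷ p) e with e ≟ₑ x
... | yes _ = cong₂ ℤ._+_ (sym (ℤP.*-identityʳ c)) (coeff≡pair p e)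
... | no _  = cong₂ ℤ._+_ (sym (ℤP.*-zeroʳ c)) (coeff≡pair p e)

pair-cong : ∀ {g h} p → (∀ x → g x ≡ h x) → pair g p ≡ pair h p
pair-cong [] eq = refl
pair-cong ((c , e) ∷ p) eq = cong₂ ℤ._+_ (cong (c ℤ.*_) (eq e)) (pair-cong p eq)

pair-⊕ : ∀ g p q → pair g (p ⊕ q) ≡ pair g p ℤ.+ pair g q
pair-⊕ g [] q = sym (ℤP.+-identityˡ _)
pair-⊕ g ((c , e) ∷ p) q =
  trans (cong (ℤ._+_ (c ℤ.* g e)) (pair-⊕ g p q)) (sym (ℤP.+-assoc (c ℤ.* g e) (pair g p) (pair g q)))

pair-⊝ : ∀ g p → pair g (⊝ p) ≡ ℤ.- pair g p
pair-⊝ g [] = refl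
pair-⊝ g ((c , e) ∷ p) = trans (cong (ℤ._+_ ((ℤ.- c) ℤ.* g e)) (pair-⊝ g p))
  (Z.solve 3 (λ c x s → (Z.:- c) Z.:* x Z.:+ (Z.:- s) Z.:= Z.:- (c Z.:* x Z.:+ s)) refl c (g e) (pair g p))

pair-scale : ∀ g p z → pair (λ x → z ℤ.* g x) p ≡ z ℤ.* pair g p
pair-scale g [] z = sym (ℤP.*-zeroʳ z)
pair-scale g ((c , e) ∷ p) z = trans (cong (ℤ._+_ (c ℤ.* (z ℤ.* g e))) (pair-scale g p z))
  (Z.solve 4 (λ c z x s → c Z.:* (z Z.:* x) Z.:+ z Z.:* s Z.:= z Z.:* (c Z.:* x Z.:+ s)) refl c z (g e) (pair g p))

pair-+ : ∀ g h p → pair (λ x → g x ℤ.+ h x) p ≡ pair g p ℤ.+ pair h p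
pair-+ g h [] = refl
pair-+ g h ((c , e) ∷ p) = trans (cong (ℤ._+_ (c ℤ.* (g e ℤ.+ h e))) (pair-+ g h p))
  (Z.solve 5 (λ c x y s t → c Z.:* (x Z.:+ y) Z.:+ (s Z.:+ t) Z.:= (c Z.:* x Z.:+ s) Z.:+ (c Z.:* y Z.:+ t)) refl
    c (g e) (h e) (pair g p) (pair h p))

pair-0 : ∀ p → pair (λ _ → 0ℤ) p ≡ 0ℤ
pair-0 [] = refl
pair-0 ((c , e) ∷ p) = cong₂ ℤ._+_ (ℤP.*-zeroʳ c) (pair-0 p)

pair-map : ∀ g c e q → pair g (map (λ s → c ℤ.* proj₁ s , e +ₑ proj₂ s) q) ≡ c ℤ.* pair (λ y → g (e +ₑ y)) q
pair-map g c e [] = sym (ℤP.*-zeroʳ c)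
pair-map g c e ((d , x) ∷ q) = trans (cong (ℤ._+_ (c ℤ.* d ℤ.* g (e +ₑ x))) (pair-map g c e q))
  (Z.solve 4 (λ c d x s → c Z.:* d Z.:* x Z.:+ c Z.:* s Z.:= c Z.:* (d Z.:* x Z.:+ s)) refl c d (g (e +ₑ x)) _)

-- Once products pair as double sums over exponents, the laws of `⊗` reduce to those of `+ₑ` and to
-- interchanging finite sums.
pair-⊗ : ∀ g p q → pair g (p ⊗ q) ≡ pair (λ x → pair (λ y → g (x +ₑ y)) q) p
pair-⊗ g [] q = refl
pair-⊗ g ((c , e) ∷ p) q = trans (pair-⊕ g (map _ q) (p ⊗ q)) (cong₂ ℤ._+_ (pair-map g c e q) (pair-⊗ g p q))

pair-swap : ∀ (h : Exp → Exp → ℤ) p q → pair (λ x → pair (h x) q) p ≡ pair (λ y → pair (λ x → h x y) p) q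
pair-swap h [] q = sym (pair-0 q)
pair-swap h ((c , e) ∷ p) q = trans
  (cong₂ ℤ._+_ (sym (pair-scale (h e) q c)) (pair-swap h p q))
  (sym (pair-+ (λ y → c ℤ.* h e y) (λ y → pair (λ x → h x y) p) q))

-- All terms with exponent e go at once: a list may repeat an exponent, and only the total
-- coefficient is visible to `≈`.
remove : Exp → LP → LP
remove e [] = []
remove e ((c , x) ∷ p) with e ≟ₑ x
... | yes _ = remove e p
... | no _  = (c , x) ∷ remove e p

remove-length : ∀ e p → length (remove e p) ℕ.≤ length p
remove-length e [] = ℕ.z≤n
remove-length e ((c , x) ∷ p) with e ≟ₑ x
... | yes _ = ℕP.m≤n⇒m≤1+n (remove-length e p)
... | no _  = ℕ.s≤s (remove-length e p)

pair-remove : ∀ g e p → pair g p ≡ coeff p e ℤ.* g e ℤ.+ pair g (remove e p)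
pair-remove g e [] = refl
pair-remove g e ((c , x) ∷ p) with e ≟ₑ x
... | yes refl = trans (cong (ℤ._+_ (c ℤ.* g e)) (pair-remove g e p))
  (Z.solve 4 (λ c x k s → c Z.:* x Z.:+ (k Z.:* x Z.:+ s) Z.:= (c Z.:+ k) Z.:* x Z.:+ s) refl c (g e) (coeff p e) _)
... | no _ = trans (cong (ℤ._+_ (c ℤ.* g x)) (pair-remove g e p))
  (Z.solve 5 (λ c x k y s → c Z.:* x Z.:+ (k Z.:* y Z.:+ s) Z.:= (Z.con 0ℤ Z.:+ k) Z.:* y Z.:+ (c Z.:* x Z.:+ s)) refl
    c (g x) (coeff p e) (g e) _)

coeff-remove : ∀ e p → coeff (remove e p) e ≡ 0ℤ
coeff-remove e [] = refl
coeff-remove e ((c , x) ∷ p) with e ≟ₑ x in eq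
... | yes _ = coeff-remove e p
... | no _ rewrite eq = trans (ℤP.+-identityˡ _) (coeff-remove e p)

coeff-remove-≢ : ∀ {e y} p → y ≢ e → coeff (remove e p) y ≡ coeff p y
coeff-remove-≢ [] y≢e = refl
coeff-remove-≢ {e} {y} ((c , x) ∷ p) y≢e with e ≟ₑ x
... | no _ = cong (ℤ._+_ (if ⌊ y ≟ₑ x ⌋ then c else 0ℤ)) (coeff-remove-≢ p y≢e)
... | yes refl with y ≟ₑ e
...   | yes y≡e = ⊥-elim (y≢e y≡e)
...   | no _ = trans (coeff-remove-≢ p y≢e) (sym (ℤP.+-identityˡ _))

-- Induction on a bound n for the length, since `remove e p` is not a sublist of the tail in the
-- structural sense. Asking only that `coeff p x ℤ.* g x` vanish allows either factor to be the zero
-- one; with p a difference this shows that pairings respect `≈`.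
pair-vanish : ∀ n g p → length p ℕ.≤ n → (∀ x → coeff p x ℤ.* g x ≡ 0ℤ) → pair g p ≡ 0ℤ
pair-vanish n g [] _ _ = refl
pair-vanish (suc n) g p@((c , e) ∷ p′) (ℕ.s≤s len) z = begin
  pair g p                                     ≡⟨ pair-remove g e p ⟩
  coeff p e ℤ.* g e ℤ.+ pair g (remove e p)    ≡⟨ cong₂ ℤ._+_ (z e) (pair-vanish n g (remove e p) shorter z′) ⟩
  0ℤ                                           ∎
  where
  open ≡-Reasoning
  shorter : length (remove e p) ℕ.≤ n
  shorter with e ≟ₑ e
  ... | yes _ = ℕP.≤-trans (remove-length e p′) len
  ... | no e≢e = ⊥-elim (e≢e refl)
  z′ : ∀ x → coeff (remove e p) x ℤ.* g x ≡ 0ℤ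
  z′ x with x ≟ₑ e
  ... | yes refl = cong (ℤ._* g x) (coeff-remove e p)
  ... | no x≢e = trans (cong (ℤ._* g x) (coeff-remove-≢ p x≢e)) (z x)

pair-concentrated : ∀ g p e → (∀ x → x ≢ e → coeff p x ℤ.* g x ≡ 0ℤ) → pair g p ≡ coeff p e ℤ.* g e
pair-concentrated g p e z = trans (pair-remove g e p)
  (trans (cong (ℤ._+_ (coeff p e ℤ.* g e)) (pair-vanish _ g (remove e p) ℕP.≤-refl z′)) (ℤP.+-identityʳ _))
  where
  z′ : ∀ x → coeff (remove e p) x ℤ.* g x ≡ 0ℤ
  z′ x with x ≟ₑ e
  ... | yes refl = cong (ℤ._* g x) (coeff-remove e p)
  ... | no x≢e = trans (cong (ℤ._* g x) (coeff-remove-≢ p x≢e)) (z x x≢e)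

coeff-⊕ : ∀ p q e → coeff (p ⊕ q) e ≡ coeff p e ℤ.+ coeff q e
coeff-⊕ p q e rewrite coeff≡pair (p ⊕ q) e | coeff≡pair p e | coeff≡pair q e = pair-⊕ (δ e) p q

coeff-⊝ : ∀ p e → coeff (⊝ p) e ≡ ℤ.- coeff p e
coeff-⊝ p e rewrite coeff≡pair (⊝ p) e | coeff≡pair p e = pair-⊝ (δ e) p

pair-resp : ∀ p q → p ≈ q → ∀ g → pair g p ≡ pair g q
pair-resp p q p≈q g = ℤP.i-j≡0⇒i≡j _ _ (begin
  pair g p ℤ.- pair g q  ≡⟨ cong (ℤ._+_ (pair g p)) (pair-⊝ g q) ⟨
  pair g p ℤ.+ pair g (⊝ q) ≡⟨ pair-⊕ g p (⊝ q) ⟨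
  pair g (p ⊖ q) ≡⟨ pair-vanish _ g (p ⊖ q) ℕP.≤-refl (λ x → cong (ℤ._* g x) (begin
     coeff (p ⊖ q) x ≡⟨ coeff-⊕ p (⊝ q) x ⟩
     coeff p x ℤ.+ coeff (⊝ q) x ≡⟨ cong₂ ℤ._+_ (p≈q x) (coeff-⊝ q x) ⟩
     coeff q x ℤ.- coeff q x ≡⟨ ℤP.+-inverseʳ (coeff q x) ⟩
     0ℤ ∎)) ⟩
  0ℤ ∎)
  where open ≡-Reasoning

≈-from-pair : ∀ p q → (∀ g → pair g p ≡ pair g q) → p ≈ q
≈-from-pair p q eq e = trans (coeff≡pair p e) (trans (eq (δ e)) (sym (coeff≡pair q e)))

-- Commutative ring laws

+ₑ-assoc : ∀ x y z → (x +ₑ y) +ₑ z ≡ x +ₑ (y +ₑ z)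
+ₑ-assoc (a , b , c) (a′ , b′ , c′) (a″ , b″ , c″) =
  cong₂ _,_ (ℤP.+-assoc a a′ a″) (cong₂ _,_ (ℤP.+-assoc b b′ b″) (ℤP.+-assoc c c′ c″))

+ₑ-comm : ∀ x y → x +ₑ y ≡ y +ₑ x
+ₑ-comm (a , b , c) (a′ , b′ , c′) = cong₂ _,_ (ℤP.+-comm a a′) (cong₂ _,_ (ℤP.+-comm b b′) (ℤP.+-comm c c′))

0ₑ : Exp
0ₑ = 0ℤ , 0ℤ , 0ℤ

+ₑ-identityˡ : ∀ x → 0ₑ +ₑ x ≡ x
+ₑ-identityˡ (a , b , c) = cong₂ _,_ (ℤP.+-identityˡ a) (cong₂ _,_ (ℤP.+-identityˡ b) (ℤP.+-identityˡ c))

⊗-comm : ∀ p q → p ⊗ q ≈ q ⊗ p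
⊗-comm p q = ≈-from-pair (p ⊗ q) (q ⊗ p) λ g → begin
  pair g (p ⊗ q) ≡⟨ pair-⊗ g p q ⟩
  pair (λ x → pair (λ y → g (x +ₑ y)) q) p ≡⟨ pair-swap (λ x y → g (x +ₑ y)) p q ⟩
  pair (λ y → pair (λ x → g (x +ₑ y)) p) q ≡⟨ pair-cong q (λ y → pair-cong p (λ x → cong g (+ₑ-comm x y))) ⟩
  pair (λ y → pair (λ x → g (y +ₑ x)) p) q ≡⟨ pair-⊗ g q p ⟨
  pair g (q ⊗ p) ∎
  where open ≡-Reasoning

⊗-assoc : ∀ p q r → (p ⊗ q) ⊗ r ≈ p ⊗ (q ⊗ r)
⊗-assoc p q r = ≈-from-pair ((p ⊗ q) ⊗ r) (p ⊗ (q ⊗ r)) λ g → begin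
  pair g ((p ⊗ q) ⊗ r) ≡⟨ pair-⊗ g (p ⊗ q) r ⟩
  pair (λ x → pair (λ z → g (x +ₑ z)) r) (p ⊗ q) ≡⟨ pair-⊗ _ p q ⟩
  pair (λ x → pair (λ y → pair (λ z → g ((x +ₑ y) +ₑ z)) r) q) p
    ≡⟨ pair-cong p (λ x → pair-cong q (λ y → pair-cong r (λ z → cong g (+ₑ-assoc x y z)))) ⟩
  pair (λ x → pair (λ y → pair (λ z → g (x +ₑ (y +ₑ z))) r) q) p
    ≡⟨ pair-cong p (λ x → pair-⊗ (λ y → g (x +ₑ y)) q r) ⟨
  pair (λ x → pair (λ y → g (x +ₑ y)) (q ⊗ r)) p ≡⟨ pair-⊗ g p (q ⊗ r) ⟨
  pair g (p ⊗ (q ⊗ r)) ∎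
  where open ≡-Reasoning

⊗-cong : ∀ p p′ q q′ → p ≈ p′ → q ≈ q′ → p ⊗ q ≈ p′ ⊗ q′
⊗-cong p p′ q q′ pp qq = ≈-from-pair (p ⊗ q) (p′ ⊗ q′) λ g → begin
  pair g (p ⊗ q) ≡⟨ pair-⊗ g p q ⟩
  pair (λ x → pair (λ y → g (x +ₑ y)) q) p ≡⟨ pair-cong p (λ x → pair-resp q q′ qq (λ y → g (x +ₑ y))) ⟩
  pair (λ x → pair (λ y → g (x +ₑ y)) q′) p ≡⟨ pair-resp p p′ pp _ ⟩
  pair (λ x → pair (λ y → g (x +ₑ y)) q′) p′ ≡⟨ pair-⊗ g p′ q′ ⟨
  pair g (p′ ⊗ q′) ∎
  where open ≡-Reasoning

⊗-identityˡ : ∀ p → one ⊗ p ≈ p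
⊗-identityˡ p = ≈-from-pair (one ⊗ p) p λ g → begin
  pair g (one ⊗ p) ≡⟨ pair-⊗ g one p ⟩
  1ℤ ℤ.* pair (λ y → g (0ₑ +ₑ y)) p ℤ.+ 0ℤ ≡⟨ ℤP.+-identityʳ _ ⟩
  1ℤ ℤ.* pair (λ y → g (0ₑ +ₑ y)) p ≡⟨ ℤP.*-identityˡ _ ⟩
  pair (λ y → g (0ₑ +ₑ y)) p ≡⟨ pair-cong p (λ y → cong g (+ₑ-identityˡ y)) ⟩
  pair g p ∎
  where open ≡-Reasoning

⊗-distribʳ : ∀ r p q → (p ⊕ q) ⊗ r ≈ p ⊗ r ⊕ q ⊗ r
⊗-distribʳ r p q = ≈-from-pair ((p ⊕ q) ⊗ r) (p ⊗ r ⊕ q ⊗ r) λ g → begin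
  pair g ((p ⊕ q) ⊗ r) ≡⟨ pair-⊗ g (p ⊕ q) r ⟩
  pair _ (p ⊕ q) ≡⟨ pair-⊕ _ p q ⟩
  pair _ p ℤ.+ pair _ q ≡⟨ cong₂ ℤ._+_ (pair-⊗ g p r) (pair-⊗ g q r) ⟨
  pair g (p ⊗ r) ℤ.+ pair g (q ⊗ r) ≡⟨ pair-⊕ g (p ⊗ r) (q ⊗ r) ⟨
  pair g (p ⊗ r ⊕ q ⊗ r) ∎
  where open ≡-Reasoning

-- The opaque ring and its solver

infix 4 _≋_
-- A wrapper that keeps its endpoints visible: `≈` unfolds to equations between coefficients, from
-- which p and q cannot be inferred.
record _≋_ (p q : LP) : Set where
  constructor mk≋
  field at : p ≈ q
open _≋_

infixl 6 _+_ _-_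
infixl 7 _*_
infix 8 -_

-- Opaque, because unification cannot invert the underlying list functions.
opaque
  _+_ _*_ : LP → LP → LP
  _+_ = _⊕_
  _*_ = _⊗_

  -_ : LP → LP
  -_ = ⊝_

  ι : ℤ → LP
  ι = ⟨_⟩

  ∣_∣ : LP → ℤ
  ∣_∣ = ∣_∣ₗ

  coeff-+ : ∀ p q e → coeff (p + q) e ≡ coeff p e ℤ.+ coeff q e
  coeff-+ = coeff-⊕

  coeff-* : ∀ p q e → coeff (p * q) e ≡ pair (λ x → pair (λ y → δ e (x +ₑ y)) q) p
  coeff-* p q e = trans (coeff≡pair (p ⊗ q) e) (pair-⊗ (δ e) p q)

  coeff-ι0 : ∀ e → coeff (ι 0ℤ) e ≡ 0ℤ
  coeff-ι0 e with e ≟ₑ 0ₑ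
  ... | yes _ = refl
  ... | no _ = refl

  +-cong : ∀ {p p′ q q′} → p ≋ p′ → q ≋ q′ → p + q ≋ p′ + q′
  +-cong {p} {p′} {q} {q′} pp qq = mk≋ λ e →
    trans (coeff-⊕ p q e) (trans (cong₂ ℤ._+_ (at pp e) (at qq e)) (sym (coeff-⊕ p′ q′ e)))

  *-cong : ∀ {p p′ q q′} → p ≋ p′ → q ≋ q′ → p * q ≋ p′ * q′
  *-cong {p} {p′} {q} {q′} pp qq = mk≋ (⊗-cong p p′ q q′ (at pp) (at qq))

  neg-cong : ∀ {p q} → p ≋ q → - p ≋ - q
  neg-cong {p} {q} eq = mk≋ λ e → trans (coeff-⊝ p e) (trans (cong ℤ.-_ (at eq e)) (sym (coeff-⊝ q e)))

  +-comm : ∀ p q → p + q ≋ q + p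
  +-comm p q = mk≋ λ e → trans (coeff-⊕ p q e) (trans (ℤP.+-comm (coeff p e) (coeff q e)) (sym (coeff-⊕ q p e)))

  +-assoc : ∀ p q r → (p + q) + r ≋ p + (q + r)
  +-assoc p q r = mk≋ λ e → cong (λ l → coeff l e) (++-assoc p q r)

  +-identityˡ : ∀ p → ι 0ℤ + p ≋ p
  +-identityˡ p = mk≋ λ e → trans (coeff-⊕ ⟨ 0ℤ ⟩ p e) (trans (cong (ℤ._+ coeff p e) (coeff-ι0 e)) (ℤP.+-identityˡ _))

  neg-inverseˡ : ∀ p → - p + p ≋ ι 0ℤ
  neg-inverseˡ p = mk≋ λ e → trans (coeff-⊕ (⊝ p) p e)
    (trans (cong (ℤ._+ coeff p e) (coeff-⊝ p e)) (trans (ℤP.+-inverseˡ (coeff p e)) (sym (coeff-ι0 e))))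

  *-assoc : ∀ p q r → (p * q) * r ≋ p * (q * r)
  *-assoc p q r = mk≋ (⊗-assoc p q r)

  *-comm : ∀ p q → p * q ≋ q * p
  *-comm p q = mk≋ (⊗-comm p q)

  *-identityˡ : ∀ p → ι 1ℤ * p ≋ p
  *-identityˡ p = mk≋ (⊗-identityˡ p)

  *-distribʳ : ∀ r p q → (p + q) * r ≋ p * r + q * r
  *-distribʳ r p q = mk≋ (⊗-distribʳ r p q)

  ι-+ : ∀ a b → ι (a ℤ.+ b) ≋ ι a + ι b
  ι-+ a b = mk≋ (≈-from-pair ⟨ a ℤ.+ b ⟩ (⟨ a ⟩ ⊕ ⟨ b ⟩) λ g →
    Z.solve 3 (λ a b x → (a Z.:+ b) Z.:* x Z.:+ Z.con 0ℤ Z.:= a Z.:* x Z.:+ (b Z.:* x Z.:+ Z.con 0ℤ)) refl a b (g 0ₑ))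

  ι-* : ∀ a b → ι (a ℤ.* b) ≋ ι a * ι b
  ι-* a b = mk≋ λ e → refl

  ι-neg : ∀ a → ι (ℤ.- a) ≋ - ι a
  ι-neg a = mk≋ λ e → refl

  ∣∣≡pair : ∀ p → ∣ p ∣ ≡ pair (λ _ → 1ℤ) p
  ∣∣≡pair [] = refl
  ∣∣≡pair ((c , e) ∷ p) = cong₂ ℤ._+_ (sym (ℤP.*-identityʳ c)) (∣∣≡pair p)

  ∣∣-+ : ∀ p q → ∣ p + q ∣ ≡ ∣ p ∣ ℤ.+ ∣ q ∣
  ∣∣-+ p q rewrite ∣∣≡pair (p ⊕ q) | ∣∣≡pair p | ∣∣≡pair q = pair-⊕ (λ _ → 1ℤ) p q

  ∣∣-* : ∀ p q → ∣ p * q ∣ ≡ ∣ p ∣ ℤ.* ∣ q ∣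
  ∣∣-* p q rewrite ∣∣≡pair (p ⊗ q) | ∣∣≡pair p | ∣∣≡pair q = begin
    pair (λ _ → 1ℤ) (p ⊗ q)                     ≡⟨ pair-⊗ (λ _ → 1ℤ) p q ⟩
    pair (λ _ → pair (λ _ → 1ℤ) q) p            ≡⟨ pair-cong p (λ _ → sym (ℤP.*-identityʳ _)) ⟩
    pair (λ _ → pair (λ _ → 1ℤ) q ℤ.* 1ℤ) p     ≡⟨ pair-scale (λ _ → 1ℤ) p (pair (λ _ → 1ℤ) q) ⟩
    pair (λ _ → 1ℤ) q ℤ.* pair (λ _ → 1ℤ) p     ≡⟨ ℤP.*-comm (pair (λ _ → 1ℤ) q) _ ⟩
    pair (λ _ → 1ℤ) p ℤ.* pair (λ _ → 1ℤ) q     ∎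
    where open ≡-Reasoning

  ∣∣-ι : ∀ a → ∣ ι a ∣ ≡ a
  ∣∣-ι a = ℤP.+-identityʳ a

  ∣∣-X : ∀ i → ∣ X i ∣ ≡ 1ℤ
  ∣∣-X i = refl

  ∣∣-cong : ∀ {p q} → p ≋ q → ∣ p ∣ ≡ ∣ q ∣
  ∣∣-cong {p} {q} eq = trans (∣∣≡pair p) (trans (pair-resp p q (at eq) _) (sym (∣∣≡pair q)))

  X*Xinv : ∀ i → X i * Xinv i ≋ ι 1ℤ
  X*Xinv zero = mk≋ λ e → refl
  X*Xinv (suc zero) = mk≋ λ e → refl
  X*Xinv (suc (suc zero)) = mk≋ λ e → refl

_-_ : LP → LP → LP
p - q = p + - q

≋-refl : ∀ {p} → p ≋ p
≋-refl = mk≋ λ e → refl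

≋-sym : ∀ {p q} → p ≋ q → q ≋ p
≋-sym eq = mk≋ λ e → sym (at eq e)

≋-trans : ∀ {p q r} → p ≋ q → q ≋ r → p ≋ r
≋-trans eq eq′ = mk≋ λ e → trans (at eq e) (at eq′ e)

laurentRing : CommutativeRing 0ℓ 0ℓ
laurentRing = record
  { Carrier = LP ; _≈_ = _≋_ ; _+_ = _+_ ; _*_ = _*_ ; -_ = -_ ; 0# = ι 0ℤ ; 1# = ι 1ℤ
  ; isCommutativeRing = record
    { isRing = record
      { +-isAbelianGroup = record
        { isGroup = record
          { isMonoid = record
            { isSemigroup = record
              { isMagma = record
                { isEquivalence = record { refl = ≋-refl ; sym = ≋-sym ; trans = ≋-trans }
                ; ∙-cong = +-cong }
              ; assoc = +-assoc }
            ; identity = +-identityˡ , (λ p → ≋-trans (+-comm p (ι 0ℤ)) (+-identityˡ p)) }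
          ; inverse = neg-inverseˡ , (λ p → ≋-trans (+-comm p (- p)) (neg-inverseˡ p))
          ; ⁻¹-cong = neg-cong }
        ; comm = +-comm }
      ; *-cong = *-cong
      ; *-assoc = *-assoc
      ; *-identity = *-identityˡ , (λ p → ≋-trans (*-comm p (ι 1ℤ)) (*-identityˡ p))
      ; distrib = (λ r p q → ≋-trans (*-comm r (p + q)) (≋-trans (*-distribʳ r p q)
                    (+-cong (*-comm p r) (*-comm q r)))) , *-distribʳ }
    ; *-comm = *-comm } }

ι-morphism : ℤ.+-*-rawRing -Raw-AlmostCommutative⟶ fromCommutativeRing laurentRing
ι-morphism = record
  { ⟦_⟧ = ι ; +-homo = ι-+ ; *-homo = ι-* ; -‿homo = ι-neg ; 0-homo = ≋-refl ; 1-homo = ≋-refl }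

ι-≟ : ∀ a b → Maybe (ι a ≋ ι b)
ι-≟ a b with a ℤ.≟ b
... | yes refl = just ≋-refl
... | no _ = nothing

module LPSolver = RingSolver ℤ.+-*-rawRing (fromCommutativeRing laurentRing) ι-morphism ι-≟
open LPSolver using (solve; _:=_; _:+_; _:*_; :-_; _:-_; con)

infixr 6 _⊹_
infix 8 _·₀_

_⊹_ : ∀ {p q} → p ≋ ι 0ℤ → q ≋ ι 0ℤ → p + q ≋ ι 0ℤ
p₀ ⊹ q₀ = ≋-trans (+-cong p₀ q₀) (+-identityˡ (ι 0ℤ))

_·₀_ : ∀ s {p q} → p ≋ q → s * (p - q) ≋ ι 0ℤ
_·₀_ s {p} {q} eq = ≋-trans (*-cong ≋-refl (+-cong eq ≋-refl))
  (solve 2 (λ s q → s :* (q :- q) := con 0ℤ) ≋-refl s q)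

-- Applied with d an explicit linear combination of the differences of the hypotheses.
by-combination : ∀ {l r d} → l - r ≋ d → d ≋ ι 0ℤ → l ≋ r
by-combination {l} {r} {d} eq d₀ = ≋-trans (solve 2 (λ l r → l := (l :- r) :+ r) ≋-refl l r)
  (≋-trans (+-cong (≋-trans eq d₀) ≋-refl) (+-identityˡ r))

-- Lexicographic leading terms and cancellation

infix 4 _<ₑ_
data _<ₑ_ : Exp → Exp → Set where
  <₁ : ∀ {a b c a′ b′ c′} → a ℤ.< a′ → (a , b , c) <ₑ (a′ , b′ , c′)
  <₂ : ∀ {a b c b′ c′} → b ℤ.< b′ → (a , b , c) <ₑ (a , b′ , c′)
  <₃ : ∀ {a b c c′} → c ℤ.< c′ → (a , b , c) <ₑ (a , b , c′)

data Order (x y : Exp) : Set where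
  lt : x <ₑ y → Order x y
  same : x ≡ y → Order x y
  gt : y <ₑ x → Order x y

compareₑ : ∀ x y → Order x y
compareₑ (a , b , c) (a′ , b′ , c′) with ℤP.<-cmp a a′
... | tri< l _ _ = lt (<₁ l)
... | tri> _ _ g = gt (<₁ g)
... | tri≈ _ refl _ with ℤP.<-cmp b b′
...   | tri< l _ _ = lt (<₂ l)
...   | tri> _ _ g = gt (<₂ g)
...   | tri≈ _ refl _ with ℤP.<-cmp c c′
...     | tri< l _ _ = lt (<₃ l)
...     | tri> _ _ g = gt (<₃ g)
...     | tri≈ _ refl _ = same refl

<ₑ-irrefl : ∀ {x} → ¬ x <ₑ x
<ₑ-irrefl (<₁ l) = ℤP.<-irrefl refl l
<ₑ-irrefl (<₂ l) = ℤP.<-irrefl refl l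
<ₑ-irrefl (<₃ l) = ℤP.<-irrefl refl l

<ₑ-trans : ∀ {x y z} → x <ₑ y → y <ₑ z → x <ₑ z
<ₑ-trans (<₁ l) (<₁ m) = <₁ (ℤP.<-trans l m)
<ₑ-trans (<₁ l) (<₂ _) = <₁ l
<ₑ-trans (<₁ l) (<₃ _) = <₁ l
<ₑ-trans (<₂ _) (<₁ m) = <₁ m
<ₑ-trans (<₂ l) (<₂ m) = <₂ (ℤP.<-trans l m)
<ₑ-trans (<₂ l) (<₃ _) = <₂ l
<ₑ-trans (<₃ _) (<₁ m) = <₁ m
<ₑ-trans (<₃ _) (<₂ m) = <₂ m
<ₑ-trans (<₃ l) (<₃ m) = <₃ (ℤP.<-trans l m)

+ₑ-monoˡ-< : ∀ z {x y} → x <ₑ y → x +ₑ z <ₑ y +ₑ z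
+ₑ-monoˡ-< (a , _ , _) (<₁ l) = <₁ (ℤP.+-monoˡ-< a l)
+ₑ-monoˡ-< (_ , b , _) (<₂ l) = <₂ (ℤP.+-monoˡ-< b l)
+ₑ-monoˡ-< (_ , _ , c) (<₃ l) = <₃ (ℤP.+-monoˡ-< c l)

+ₑ-monoʳ-< : ∀ z {x y} → x <ₑ y → z +ₑ x <ₑ z +ₑ y
+ₑ-monoʳ-< z {x} {y} l = subst (_<ₑ z +ₑ y) (+ₑ-comm x z) (subst (x +ₑ z <ₑ_) (+ₑ-comm y z) (+ₑ-monoˡ-< z l))

+ₑ-mono-< : ∀ {x y z w} → x <ₑ y → z <ₑ w → x +ₑ z <ₑ y +ₑ w
+ₑ-mono-< {y = y} {z = z} l m = <ₑ-trans (+ₑ-monoˡ-< z l) (+ₑ-monoʳ-< y m)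

Below : LP → Exp → Set
Below p e = ∀ x → e <ₑ x → coeff p x ≡ 0ℤ

-- The coefficient c may be zero, so e is merely an upper bound for the support. Thus two
-- polynomials with different leading exponents can both be measured at the larger one.
record Lead (p : LP) (e : Exp) (c : ℤ) : Set where
  constructor _,_
  field
    below : Below p e
    top : coeff p e ≡ c
open Lead

-- If x +ₑ y exceeds e +ₑ e′, then x exceeds e or y exceeds e′, so every contribution to the
-- coefficient has a zero factor.
Below-* : ∀ p q {e e′} → Below p e → Below q e′ → Below (p * q) (e +ₑ e′)
Below-* p q {e} {e′} bp bq z e+e′<z = trans (coeff-* p q z) (pair-vanish _ _ p ℕP.≤-refl outer)
  where
  inner : ∀ x → (∀ y → x +ₑ y ≡ z → e′ <ₑ y) → pair (λ y → δ z (x +ₑ y)) q ≡ 0ℤ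
  inner x big = pair-vanish _ _ q ℕP.≤-refl vanish
    where
    vanish : ∀ y → coeff q y ℤ.* δ z (x +ₑ y) ≡ 0ℤ
    vanish y with z ≟ₑ (x +ₑ y)
    ... | yes z≡ = trans (ℤP.*-identityʳ _) (bq y (big y (sym z≡)))
    ... | no _ = ℤP.*-zeroʳ (coeff q y)
  cmp : ∀ x → (x <ₑ e ⊎ x ≡ e) → ∀ y → x +ₑ y ≡ z → e′ <ₑ y
  cmp x x≤e y refl with compareₑ e′ y | x≤e
  ... | lt l | _ = l
  ... | same refl | inj₁ x<e = ⊥-elim (<ₑ-irrefl (<ₑ-trans e+e′<z (+ₑ-monoˡ-< e′ x<e)))
  ... | same refl | inj₂ refl = ⊥-elim (<ₑ-irrefl e+e′<z)
  ... | gt g | inj₁ x<e = ⊥-elim (<ₑ-irrefl (<ₑ-trans e+e′<z (+ₑ-mono-< x<e g)))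
  ... | gt g | inj₂ refl = ⊥-elim (<ₑ-irrefl (<ₑ-trans e+e′<z (+ₑ-monoʳ-< x g)))
  outer : ∀ x → coeff p x ℤ.* pair (λ y → δ z (x +ₑ y)) q ≡ 0ℤ
  outer x with compareₑ e x
  ... | lt e<x = cong (ℤ._* _) (bp x e<x)
  ... | same e≡x = trans (cong (coeff p x ℤ.*_) (inner x (cmp x (inj₂ (sym e≡x))))) (ℤP.*-zeroʳ (coeff p x))
  ... | gt x<e = trans (cong (coeff p x ℤ.*_) (inner x (cmp x (inj₁ x<e)))) (ℤP.*-zeroʳ (coeff p x))

-- Strict monotonicity of `+ₑ` leaves (e, e′) as the only pair of exponents within the bounds that
-- sums to e +ₑ e′; all other terms of the double sum drop out.
top-* : ∀ p q {e e′} → Below p e → Below q e′ → coeff (p * q) (e +ₑ e′) ≡ coeff p e ℤ.* coeff q e′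
top-* p q {e} {e′} bp bq = begin
  coeff (p * q) z                          ≡⟨ coeff-* p q z ⟩
  pair (λ x → pair (λ y → δ z (x +ₑ y)) q) p  ≡⟨ pair-concentrated _ p e outer ⟩
  coeff p e ℤ.* pair (λ y → δ z (e +ₑ y)) q  ≡⟨ cong (coeff p e ℤ.*_) (pair-concentrated _ q e′ inner) ⟩
  coeff p e ℤ.* (coeff q e′ ℤ.* δ z z)     ≡⟨ cong (λ d → coeff p e ℤ.* (coeff q e′ ℤ.* d)) (δ-diag z) ⟩
  coeff p e ℤ.* (coeff q e′ ℤ.* 1ℤ)        ≡⟨ cong (coeff p e ℤ.*_) (ℤP.*-identityʳ (coeff q e′)) ⟩
  coeff p e ℤ.* coeff q e′                 ∎
  where
  open ≡-Reasoning
  z = e +ₑ e′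
  inner : ∀ y → y ≢ e′ → coeff q y ℤ.* δ z (e +ₑ y) ≡ 0ℤ
  inner y y≢e′ = trans (cong (coeff q y ℤ.*_) (δ-off z≢)) (ℤP.*-zeroʳ (coeff q y))
    where
    z≢ : z ≢ e +ₑ y
    z≢ z≡ with compareₑ e′ y
    ... | lt l = <ₑ-irrefl (subst (_<ₑ e +ₑ y) z≡ (+ₑ-monoʳ-< e l))
    ... | same e≡ = y≢e′ (sym e≡)
    ... | gt g = <ₑ-irrefl (subst (e +ₑ y <ₑ_) z≡ (+ₑ-monoʳ-< e g))
  outer : ∀ x → x ≢ e → coeff p x ℤ.* pair (λ y → δ z (x +ₑ y)) q ≡ 0ℤ
  outer x x≢e with compareₑ e x
  ... | lt e<x = cong (ℤ._* _) (bp x e<x)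
  ... | same e≡x = ⊥-elim (x≢e (sym e≡x))
  ... | gt x<e = trans (cong (coeff p x ℤ.*_) (pair-vanish _ _ q ℕP.≤-refl vanish)) (ℤP.*-zeroʳ (coeff p x))
    where
    vanish : ∀ y → coeff q y ℤ.* δ z (x +ₑ y) ≡ 0ℤ
    vanish y with z ≟ₑ (x +ₑ y)
    ... | no _ = ℤP.*-zeroʳ (coeff q y)
    ... | yes z≡ with compareₑ e′ y
    ...   | lt l = trans (ℤP.*-identityʳ _) (bq y l)
    ...   | same refl = ⊥-elim (<ₑ-irrefl (subst (x +ₑ e′ <ₑ_) z≡ (+ₑ-monoˡ-< e′ x<e)))
    ...   | gt g = ⊥-elim (<ₑ-irrefl (subst (x +ₑ y <ₑ_) z≡ (+ₑ-mono-< x<e g)))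

Lead-* : ∀ {p q e e′ c c′} → Lead p e c → Lead q e′ c′ → Lead (p * q) (e +ₑ e′) (c ℤ.* c′)
Lead-* {p} {q} (bp , refl) (bq , refl) = Below-* p q bp bq , top-* p q bp bq

Lead-+ : ∀ {p q e c c′} → Lead p e c → Lead q e c′ → Lead (p + q) e (c ℤ.+ c′)
Lead-+ {p} {q} (bp , refl) (bq , refl) =
  (λ x l → trans (coeff-+ p q x) (cong₂ ℤ._+_ (bp x l) (bq x l))) , coeff-+ p q _

Lead-cong : ∀ {p q e c} → p ≋ q → Lead p e c → Lead q e c
Lead-cong eq (b , c≡) = (λ x l → trans (sym (at eq x)) (b x l)) , trans (sym (at eq _)) c≡

Lead-unique : ∀ {p e e′ c c′} → Lead p e c → Lead p e′ c′ → c ≢ 0ℤ → c′ ≢ 0ℤ → e ≡ e′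
Lead-unique {e = e} {e′} (b , refl) (b′ , refl) c≢0 c′≢0 with compareₑ e e′
... | lt l = ⊥-elim (c′≢0 (b _ l))
... | same e≡e′ = e≡e′
... | gt g = ⊥-elim (c≢0 (b′ _ g))

maxNonzero : ∀ p (es : List Exp) →
  All (λ x → coeff p x ≡ 0ℤ) es ⊎
  (Σ Exp λ m → coeff p m ≢ 0ℤ × All (λ x → m <ₑ x → coeff p x ≡ 0ℤ) es)
maxNonzero p [] = inj₁ []
maxNonzero p (e ∷ es) with coeff p e ℤ.≟ 0ℤ | maxNonzero p es
... | yes z | inj₁ zs = inj₁ (z ∷ zs)
... | yes z | inj₂ (m , m≢0 , above) = inj₂ (m , m≢0 , (λ _ → z) ∷ above)
... | no nz | inj₁ zs = inj₂ (e , nz , (λ l → ⊥-elim (<ₑ-irrefl l)) ∷ All.map (λ z _ → z) zs)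
... | no nz | inj₂ (m , m≢0 , above) with compareₑ m e
...   | lt m<e = inj₂ (e , nz , (λ l → ⊥-elim (<ₑ-irrefl l)) ∷ All.map (λ f l → f (<ₑ-trans m<e l)) above)
...   | same refl = inj₂ (e , nz , (λ l → ⊥-elim (<ₑ-irrefl l)) ∷ above)
...   | gt e<m = inj₂ (m , m≢0 , (λ l → ⊥-elim (<ₑ-irrefl (<ₑ-trans l e<m))) ∷ above)

-- Extends a property checked on the finitely many listed exponents to arbitrary ones.
coeff-support : ∀ {A : Set} p x → All (λ y → y ≡ x → A) (map proj₂ p) → A ⊎ coeff p x ≡ 0ℤ
coeff-support [] x [] = inj₂ refl
coeff-support ((c , e) ∷ p) x (f ∷ fs) with x ≟ₑ e
... | yes x≡e = inj₁ (f (sym x≡e))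
... | no _ with coeff-support p x fs
...   | inj₁ a = inj₁ a
...   | inj₂ z = inj₂ (trans (ℤP.+-identityˡ _) z)

lead : ∀ p → p ≋ ι 0ℤ ⊎ Σ Exp λ e → Σ ℤ λ c → (c ≢ 0ℤ) × Lead p e c
lead p with maxNonzero p (map proj₂ p)
... | inj₁ zs = inj₁ (mk≋ λ x → trans (vanish x) (sym (coeff-ι0 x)))
  where
  vanish : ∀ x → coeff p x ≡ 0ℤ
  vanish x with coeff-support p x (All.map (λ z y≡x → subst (λ w → coeff p w ≡ 0ℤ) y≡x z) zs)
  ... | inj₁ z = z
  ... | inj₂ z = z
... | inj₂ (m , m≢0 , above) = inj₂ (m , coeff p m , m≢0 , (bounded , refl))
  where
  bounded : Below p m
  bounded x l with coeff-support p x
    (All.map (λ f y≡x → subst (λ w → coeff p w ≡ 0ℤ) y≡x (f (subst (m <ₑ_) (sym y≡x) l))) above)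
  ... | inj₁ z = z
  ... | inj₂ z = z

Lead-nonzero : ∀ {p e c} → Lead p e c → c ≢ 0ℤ → ¬ p ≋ ι 0ℤ
Lead-nonzero (_ , refl) c≢0 p≋0 = c≢0 (trans (at p≋0 _) (coeff-ι0 _))

-- Leading coefficients multiply in ℤ, which has no zero divisors.
nonzero-product : ∀ {p q} → ¬ q ≋ ι 0ℤ → p * q ≋ ι 0ℤ → p ≋ ι 0ℤ
nonzero-product {p} {q} q≢0 pq≋0 with lead p | lead q
... | inj₁ p≋0 | _ = p≋0
... | inj₂ _ | inj₁ q≋0 = ⊥-elim (q≢0 q≋0)
... | inj₂ (e , c , c≢0 , lp) | inj₂ (e′ , c′ , c′≢0 , lq) =
  ⊥-elim (Lead-nonzero (Lead-* lp lq) cc′≢0 pq≋0)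
  where
  cc′≢0 : c ℤ.* c′ ≢ 0ℤ
  cc′≢0 cc′≡0 with ℤP.i*j≡0⇒i≡0∨j≡0 c cc′≡0
  ... | inj₁ c≡0 = c≢0 c≡0
  ... | inj₂ c′≡0 = c′≢0 c′≡0

*-cancelʳ : ∀ {p q} r → ¬ r ≋ ι 0ℤ → p * r ≋ q * r → p ≋ q
*-cancelʳ {p} {q} r r≢0 pr≋qr = by-combination (solve 2 (λ p q → p :- q := p :- q) ≋-refl p q)
  (nonzero-product r≢0 (by-combination
    (solve 3 (λ p q r → (p :- q) :* r :- con 0ℤ := con 1ℤ :* (p :* r :- q :* r)) ≋-refl p q r)
    (ι 1ℤ ·₀ pr≋qr)))

0<∣∣⇒nonzero : ∀ {p} → 0ℤ ℤ.< ∣ p ∣ → ¬ p ≋ ι 0ℤ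
0<∣∣⇒nonzero pos p≋0 = ℤP.<-irrefl (sym (trans (∣∣-cong p≋0) (∣∣-ι 0ℤ))) pos

pattern 0F = zero
pattern 1F = suc zero
pattern 2F = suc (suc zero)

-- Growth of values under exchange

0<* : ∀ {x y} → 0ℤ ℤ.< x → 0ℤ ℤ.< y → 0ℤ ℤ.< x ℤ.* y
0<* {x} {y} 0<x 0<y = ℤP.*-monoʳ-<-pos y ⦃ ℤ.positive 0<y ⦄ 0<x

0≤* : ∀ {x y} → 0ℤ ℤ.≤ x → 0ℤ ℤ.≤ y → 0ℤ ℤ.≤ x ℤ.* y
0≤* {x} {y} 0≤x 0≤y = ℤP.*-monoʳ-≤-nonNeg y ⦃ ℤ.nonNegative 0≤y ⦄ 0≤x

0≤κbc : ∀ κ {b c} → 0ℤ ℤ.≤ b → 0ℤ ℤ.≤ c → 0ℤ ℤ.≤ (+ κ) ℤ.* b ℤ.* c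
0≤κbc κ {b} {c} 0≤b 0≤c = 0≤* {(+ κ) ℤ.* b} {c} (0≤* {+ κ} {b} (ℤ.+≤+ ℕ.z≤n) 0≤b) 0≤c

positive-factor : ∀ {x y} → 0ℤ ℤ.< y → 0ℤ ℤ.< x ℤ.* y → 0ℤ ℤ.< x
positive-factor {x} {y} 0<y 0<xy = ℤP.*-cancelʳ-<-nonNeg y ⦃ ℤ.nonNegative (ℤP.<⇒≤ 0<y) ⦄ 0<xy

exchℤ : ℕ → ℤ → ℤ → ℤ
exchℤ κ b c = b ℤ.* b ℤ.+ (+ κ) ℤ.* b ℤ.* c ℤ.+ c ℤ.* c

exchℤ-positive : ∀ κ {b c} → 0ℤ ℤ.≤ b → 0ℤ ℤ.≤ c → 0ℤ ℤ.< b ⊎ 0ℤ ℤ.< c → 0ℤ ℤ.< exchℤ κ b c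
exchℤ-positive κ 0≤b 0≤c (inj₁ 0<b) =
  ℤP.+-mono-<-≤ (ℤP.+-mono-<-≤ (0<* 0<b 0<b) (0≤κbc κ 0≤b 0≤c)) (0≤* 0≤c 0≤c)
exchℤ-positive κ 0≤b 0≤c (inj₂ 0<c) =
  ℤP.+-mono-≤-< (ℤP.+-mono-≤ (0≤* 0≤b 0≤b) (0≤κbc κ 0≤b 0≤c)) (0<* 0<c 0<c)

-- The product y a = b² + κ b c + c² exceeds b² ≥ b a. With b a largest entry, replacing another
-- entry a thus creates a new strict maximum.
exchange-grows : ∀ κ {y a b c} → y ℤ.* a ≡ exchℤ κ b c → 0ℤ ℤ.< a → a ℤ.≤ b → 0ℤ ℤ.< c → b ℤ.< y
exchange-grows κ {y} {a} {b} {c} ya≡ 0<a a≤b 0<c =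
  ℤP.*-cancelʳ-<-nonNeg a ⦃ ℤ.nonNegative (ℤP.<⇒≤ 0<a) ⦄ (begin-strict
    b ℤ.* a                                    ≤⟨ ℤP.*-monoˡ-≤-nonNeg b ⦃ ℤ.nonNegative 0≤b ⦄ a≤b ⟩
    b ℤ.* b                                    ≡⟨ ℤP.+-identityʳ _ ⟨
    b ℤ.* b ℤ.+ 0ℤ                             ≤⟨ ℤP.+-monoʳ-≤ (b ℤ.* b) (0≤κbc κ 0≤b (ℤP.<⇒≤ 0<c)) ⟩
    b ℤ.* b ℤ.+ (+ κ) ℤ.* b ℤ.* c              ≡⟨ ℤP.+-identityʳ _ ⟨
    b ℤ.* b ℤ.+ (+ κ) ℤ.* b ℤ.* c ℤ.+ 0ℤ       <⟨ ℤP.+-monoʳ-< (b ℤ.* b ℤ.+ (+ κ) ℤ.* b ℤ.* c) (0<* 0<c 0<c) ⟩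
    exchℤ κ b c                                ≡⟨ ya≡ ⟨
    y ℤ.* a                                    ∎)
  where
  open ℤP.≤-Reasoning
  0≤b = ℤP.≤-trans (ℤP.<⇒≤ 0<a) a≤b

exchℤ-sym : ∀ κ b c → exchℤ κ b c ≡ exchℤ κ c b
exchℤ-sym κ b c = Z.solve 3 (λ κ b c → b Z.:* b Z.:+ κ Z.:* b Z.:* c Z.:+ c Z.:* c
  Z.:= c Z.:* c Z.:+ κ Z.:* c Z.:* b Z.:+ b Z.:* b) refl (+ κ) b c

exchLP : ℕ → LP → LP → LP
exchLP κ b c = b * b + ι (+ κ) * b * c + c * c

exchLP-cong : ∀ κ {b b′ c c′} → b ≋ b′ → c ≋ c′ → exchLP κ b c ≋ exchLP κ b′ c′
exchLP-cong κ bb cc = +-cong (+-cong (*-cong bb bb) (*-cong (*-cong ≋-refl bb) cc)) (*-cong cc cc)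

exchLP-sym : ∀ κ b c → exchLP κ b c ≋ exchLP κ c b
exchLP-sym κ b c = solve 3 (λ κ b c → b :* b :+ κ :* b :* c :+ c :* c := c :* c :+ κ :* c :* b :+ b :* b)
  ≋-refl (ι (+ κ)) b c

∣exchLP∣ : ∀ κ b c → ∣ exchLP κ b c ∣ ≡ exchℤ κ ∣ b ∣ ∣ c ∣
∣exchLP∣ κ b c
  rewrite ∣∣-+ (b * b + ι (+ κ) * b * c) (c * c) | ∣∣-+ (b * b) (ι (+ κ) * b * c) | ∣∣-* b b | ∣∣-* c c
        | ∣∣-* (ι (+ κ) * b) c | ∣∣-* (ι (+ κ)) b | ∣∣-ι (+ κ) = refl

∣exchange∣ : ∀ κ {y a b c} → y * a ≋ exchLP κ b c → ∣ y ∣ ℤ.* ∣ a ∣ ≡ exchℤ κ ∣ b ∣ ∣ c ∣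
∣exchange∣ κ {y} {a} {b} {c} h = trans (sym (∣∣-* y a)) (trans (∣∣-cong h) (∣exchLP∣ κ b c))

-- Parity of leading exponents

-- Congruence modulo 2 to the exponent vector of the i-th variable.
_∼_ : Exp → Fin 3 → Set
e ∼ i = Σ Exp λ d → e ≡ unitExp 1ℤ i +ₑ (d +ₑ d)

odd≢even : ∀ x y → 1ℤ ℤ.+ (x ℤ.+ x) ≢ 0ℤ ℤ.+ (y ℤ.+ y)
odd≢even x y eq = one≢double ℤ.∣ y ℤ.- x ∣ (begin
  1                             ≡⟨ cong ℤ.∣_∣ (Z.solve 1 (λ x → Z.con 1ℤ Z.:= (Z.con 1ℤ Z.:+ (x Z.:+ x)) Z.:- (x Z.:+ x)) refl x) ⟩
  ℤ.∣ (1ℤ ℤ.+ (x ℤ.+ x)) ℤ.- (x ℤ.+ x) ∣  ≡⟨ cong (λ z → ℤ.∣ z ℤ.- (x ℤ.+ x) ∣) eq ⟩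
  ℤ.∣ (0ℤ ℤ.+ (y ℤ.+ y)) ℤ.- (x ℤ.+ x) ∣
    ≡⟨ cong ℤ.∣_∣ (Z.solve 2 (λ x y → (Z.con 0ℤ Z.:+ (y Z.:+ y)) Z.:- (x Z.:+ x) Z.:= Z.con (+ 2) Z.:* (y Z.:- x)) refl x y) ⟩
  ℤ.∣ + 2 ℤ.* (y ℤ.- x) ∣       ≡⟨ ℤP.abs-* (+ 2) (y ℤ.- x) ⟩
  2 ℕ.* ℤ.∣ y ℤ.- x ∣           ∎)
  where
  open ≡-Reasoning
  one≢double : ∀ n → 1 ≢ 2 ℕ.* n
  one≢double (suc n) eq rewrite ℕP.+-suc n (n ℕ.+ 0) with eq
  ... | ()

∼-unique : ∀ {e} i j → e ∼ i → e ∼ j → i ≡ j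
∼-unique 0F 0F _ _ = refl
∼-unique 1F 1F _ _ = refl
∼-unique 2F 2F _ _ = refl
∼-unique 0F 1F (d , refl) (d′ , eq) = ⊥-elim (odd≢even (proj₁ d) (proj₁ d′) (cong proj₁ eq))
∼-unique 0F 2F (d , refl) (d′ , eq) = ⊥-elim (odd≢even (proj₁ d) (proj₁ d′) (cong proj₁ eq))
∼-unique 1F 0F (d , refl) (d′ , eq) = ⊥-elim (odd≢even (proj₁ (proj₂ d)) (proj₁ (proj₂ d′)) (cong (λ e → proj₁ (proj₂ e)) eq))
∼-unique 1F 2F (d , refl) (d′ , eq) = ⊥-elim (odd≢even (proj₁ (proj₂ d)) (proj₁ (proj₂ d′)) (cong (λ e → proj₁ (proj₂ e)) eq))
∼-unique 2F 0F (d , refl) (d′ , eq) = ⊥-elim (odd≢even (proj₂ (proj₂ d)) (proj₂ (proj₂ d′)) (cong (λ e → proj₂ (proj₂ e)) eq))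
∼-unique 2F 1F (d , refl) (d′ , eq) = ⊥-elim (odd≢even (proj₂ (proj₂ d)) (proj₂ (proj₂ d′)) (cong (λ e → proj₂ (proj₂ e)) eq))

∼-exchange : ∀ i {e e′ m} → e ∼ i → e′ +ₑ e ≡ m +ₑ m → e′ ∼ i
∼-exchange i {e′ = e₁ , e₂ , e₃} {m₁ , m₂ , m₃} ((d₁ , d₂ , d₃) , refl) eq with unitExp 1ℤ i
-- With e = u + 2d, the exponent 2m - e equals u + 2(m - u - d).
... | u₁ , u₂ , u₃ = (m₁ ℤ.- u₁ ℤ.- d₁ , m₂ ℤ.- u₂ ℤ.- d₂ , m₃ ℤ.- u₃ ℤ.- d₃) ,
  cong₂ _,_ (double e₁ u₁ d₁ m₁ (cong proj₁ eq))
    (cong₂ _,_ (double e₂ u₂ d₂ m₂ (cong (λ e → proj₁ (proj₂ e)) eq)) (double e₃ u₃ d₃ m₃ (cong (λ e → proj₂ (proj₂ e)) eq)))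
  where
  double : ∀ e u d m → e ℤ.+ (u ℤ.+ (d ℤ.+ d)) ≡ m ℤ.+ m → e ≡ u ℤ.+ ((m ℤ.- u ℤ.- d) ℤ.+ (m ℤ.- u ℤ.- d))
  double e u d m h = begin
    e  ≡⟨ Z.solve 3 (λ e u d → e Z.:= (e Z.:+ (u Z.:+ (d Z.:+ d))) Z.:- (u Z.:+ (d Z.:+ d))) refl e u d ⟩
    (e ℤ.+ (u ℤ.+ (d ℤ.+ d))) ℤ.- (u ℤ.+ (d ℤ.+ d)) ≡⟨ cong (ℤ._- (u ℤ.+ (d ℤ.+ d))) h ⟩
    (m ℤ.+ m) ℤ.- (u ℤ.+ (d ℤ.+ d))
      ≡⟨ Z.solve 3 (λ u d m → (m Z.:+ m) Z.:- (u Z.:+ (d Z.:+ d)) Z.:= u Z.:+ ((m Z.:- u Z.:- d) Z.:+ (m Z.:- u Z.:- d))) refl u d m ⟩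
    u ℤ.+ ((m ℤ.- u ℤ.- d) ℤ.+ (m ℤ.- u ℤ.- d)) ∎
    where open ≡-Reasoning

-- The sign matters: if b and c had the same leading exponent and opposite leading coefficients, the
-- top term of b² + κ b c + c² would vanish for κ = 2.
PositiveLead : LP → Exp → Set
PositiveLead p e = Σ ℤ λ c → 0ℤ ℤ.< c × Lead p e c

0<⇒≢0 : ∀ {z} → 0ℤ ℤ.< z → z ≢ 0ℤ
0<⇒≢0 0<z z≡0 = ℤP.<-irrefl (sym z≡0) 0<z

PositiveLead-unique : ∀ {p e e′} → PositiveLead p e → PositiveLead p e′ → e ≡ e′
PositiveLead-unique (c , 0<c , h) (c′ , 0<c′ , h′) = Lead-unique h h′ (0<⇒≢0 0<c) (0<⇒≢0 0<c′)

Lead-mono : ∀ {p e e′ c} → Lead p e c → e <ₑ e′ → Lead p e′ 0ℤ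
Lead-mono (b , _) l = (λ x l′ → b x (<ₑ-trans l l′)) , b _ l

Lead-ι : ∀ z → Lead (ι z) 0ₑ z
Lead-ι z = bounded , leading
  where
  opaque
    unfolding ι
    bounded : Below (ι z) 0ₑ
    bounded x l with x ≟ₑ 0ₑ
    ... | yes refl = ⊥-elim (<ₑ-irrefl l)
    ... | no _ = refl
    leading : coeff (ι z) 0ₑ ≡ z
    leading = ℤP.+-identityʳ z

Lead-X : ∀ i → Lead (X i) (unitExp 1ℤ i) 1ℤ
Lead-X i = bounded , leading
  where
  bounded : Below (X i) (unitExp 1ℤ i)
  bounded x l with x ≟ₑ unitExp 1ℤ i
  ... | yes refl = ⊥-elim (<ₑ-irrefl l)
  ... | no _ = refl
  leading : coeff (X i) (unitExp 1ℤ i) ≡ 1ℤ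
  leading with unitExp 1ℤ i ≟ₑ unitExp 1ℤ i
  ... | yes _ = refl
  ... | no ne = ⊥-elim (ne refl)

Lead-exchLP : ∀ κ {b c e s t} → Lead b e s → Lead c e t → Lead (exchLP κ b c) (e +ₑ e) (exchℤ κ s t)
Lead-exchLP κ {b} {c} {e} {s} {t} hb hc = Lead-+ (Lead-+ (Lead-* hb hb)
  (subst (λ x → Lead (ι (+ κ) * b * c) (x +ₑ e) _) (+ₑ-identityˡ e) (Lead-* (Lead-* (Lead-ι (+ κ)) hb) hc))) (Lead-* hc hc)

PositiveLead-exchLP : ∀ κ {b c e e′} → PositiveLead b e → PositiveLead c e′ →
  Σ Exp λ m → PositiveLead (exchLP κ b c) (m +ₑ m)
PositiveLead-exchLP κ {e = e} {e′} (s , 0<s , hb) (t , 0<t , hc) with compareₑ e e′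
... | lt l = e′ , _ , exchℤ-positive κ ℤP.≤-refl (ℤP.<⇒≤ 0<t) (inj₂ 0<t) , Lead-exchLP κ (Lead-mono hb l) hc
... | same refl = e′ , _ , exchℤ-positive κ (ℤP.<⇒≤ 0<s) (ℤP.<⇒≤ 0<t) (inj₂ 0<t) , Lead-exchLP κ hb hc
... | gt l = e , _ , exchℤ-positive κ (ℤP.<⇒≤ 0<s) ℤP.≤-refl (inj₁ 0<s) , Lead-exchLP κ hb (Lead-mono hc l)

record HasParity (p : LP) (i : Fin 3) : Set where
  constructor hasParity
  field
    {exponent} : Exp
    leading : PositiveLead p exponent
    residue : exponent ∼ i

HasParity-cong : ∀ {p q i} → p ≋ q → HasParity p i → HasParity q i
HasParity-cong p≋q (hasParity (c , 0<c , h) r) = hasParity (c , 0<c , Lead-cong p≋q h) r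

HasParity-unique : ∀ {p i j} → HasParity p i → HasParity p j → i ≡ j
HasParity-unique {i = i} {j} (hasParity h e∼i) (hasParity h′ e′∼j) =
  ∼-unique i j e∼i (subst (_∼ j) (sym (PositiveLead-unique h h′)) e′∼j)

HasParity-exchange : ∀ κ i {y a b c j j′} → y * a ≋ exchLP κ b c →
  HasParity a i → HasParity b j → HasParity c j′ → HasParity y i
HasParity-exchange κ i {y} {a} {b} {c} h (hasParity {e} (s , 0<s , ha) e∼i) (hasParity hb _) (hasParity hc _)
  with PositiveLead-exchLP κ hb hc | lead y
... | m , t , 0<t , hm | inj₁ y≋0 = ⊥-elim (Lead-nonzero (Lead-cong (≋-sym h) hm) (0<⇒≢0 0<t)
  (≋-trans (*-cong y≋0 ≋-refl) (solve 1 (λ a → con 0ℤ :* a := con 0ℤ) ≋-refl a)))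
... | m , t , 0<t , hm | inj₂ (e′ , r , r≢0 , hy) = hasParity (r , 0<r , hy) (∼-exchange i {m = m} e∼i e′e≡mm)
  where
  product : Lead (exchLP κ b c) (e′ +ₑ e) (r ℤ.* s)
  product = Lead-cong h (Lead-* hy ha)
  rs≢0 : r ℤ.* s ≢ 0ℤ
  rs≢0 rs≡0 with ℤP.i*j≡0⇒i≡0∨j≡0 r rs≡0
  ... | inj₁ r≡0 = r≢0 r≡0
  ... | inj₂ s≡0 = 0<⇒≢0 0<s s≡0
  e′e≡mm : e′ +ₑ e ≡ m +ₑ m
  e′e≡mm = Lead-unique product hm rs≢0 (0<⇒≢0 0<t)
  -- Comparing leading coefficients in the exchange relation gives r s = t with s and t positive, so
  -- positivity passes on to the new variable.
  0<r : 0ℤ ℤ.< r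
  0<r = positive-factor 0<s (subst (0ℤ ℤ.<_)
    (trans (sym (top hm)) (trans (cong (coeff (exchLP κ b c)) (sym e′e≡mm)) (top product))) 0<t)

HasParity-X : ∀ i → HasParity (X i) i
HasParity-X 0F = hasParity (1ℤ , ℤ.+<+ (ℕ.s≤s ℕ.z≤n) , Lead-X 0F) (0ₑ , refl)
HasParity-X 1F = hasParity (1ℤ , ℤ.+<+ (ℕ.s≤s ℕ.z≤n) , Lead-X 1F) (0ₑ , refl)
HasParity-X 2F = hasParity (1ℤ , ℤ.+<+ (ℕ.s≤s ℕ.z≤n) , Lead-X 2F) (0ₑ , refl)

-- Clusters

opaque
  𝐌 : K → LP
  𝐌 = 𝓜

κ : K → Fin 3 → LP
κ k i = ι (+ kAt k i)

-- Each κ multiplies the two unknowns other than its own, so a permutation of the unknowns carries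
-- the κ's along with them.
record Markov (M κa κb κc a b c : LP) : Set where
  constructor mkMarkov
  field equation : a * a + b * b + c * c + κa * b * c + κb * a * c + κc * a * b ≋ M * a * b * c
open Markov

module _ {M κa κb κc a b c : LP} where
  Markov-swap₁₂ : Markov M κa κb κc a b c → Markov M κb κa κc b a c
  Markov-swap₁₂ (mkMarkov h) = mkMarkov (by-combination
    (solve 7 (λ M κa κb κc a b c →
      b :* b :+ a :* a :+ c :* c :+ κb :* a :* c :+ κa :* b :* c :+ κc :* b :* a :- M :* b :* a :* c :=
      con 1ℤ :* (a :* a :+ b :* b :+ c :* c :+ κa :* b :* c :+ κb :* a :* c :+ κc :* a :* b :- M :* a :* b :* c))
      ≋-refl M κa κb κc a b c) (ι 1ℤ ·₀ h))

  Markov-swap₂₃ : Markov M κa κb κc a b c → Markov M κa κc κb a c b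
  Markov-swap₂₃ (mkMarkov h) = mkMarkov (by-combination
    (solve 7 (λ M κa κb κc a b c →
      a :* a :+ c :* c :+ b :* b :+ κa :* c :* b :+ κc :* a :* b :+ κb :* a :* c :- M :* a :* c :* b :=
      con 1ℤ :* (a :* a :+ b :* b :+ c :* c :+ κa :* b :* c :+ κb :* a :* c :+ κc :* a :* b :- M :* a :* b :* c))
      ≋-refl M κa κb κc a b c) (ι 1ℤ ·₀ h))

  Markov-cong : ∀ {a′ b′ c′} → a ≋ a′ → b ≋ b′ → c ≋ c′ →
    Markov M κa κb κc a b c → Markov M κa κb κc a′ b′ c′
  Markov-cong aa bb cc (mkMarkov h) = mkMarkov (≋-trans (≋-sym
    (+-cong (+-cong (+-cong (+-cong (+-cong (*-cong aa aa) (*-cong bb bb)) (*-cong cc cc))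
      (*-cong (*-cong ≋-refl bb) cc)) (*-cong (*-cong ≋-refl aa) cc)) (*-cong (*-cong ≋-refl aa) bb)))
    (≋-trans h (*-cong (*-cong (*-cong ≋-refl aa) bb) cc)))

  -- b and y are the two roots of the Markov equation seen as a quadratic in its second unknown.
  root-sum : ∀ {y} → Markov M κa κb κc a b c → ¬ b ≋ ι 0ℤ → y * b ≋ a * a + κb * a * c + c * c →
    y + b + κa * c + κc * a ≋ M * a * c
  root-sum {y} (mkMarkov h) b≢0 ex = *-cancelʳ b b≢0 (by-combination
    (solve 8 (λ M κa κb κc a b c y →
      (y :+ b :+ κa :* c :+ κc :* a) :* b :- M :* a :* c :* b :=
      con 1ℤ :* (a :* a :+ b :* b :+ c :* c :+ κa :* b :* c :+ κb :* a :* c :+ κc :* a :* b :- M :* a :* b :* c)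
      :+ con 1ℤ :* (y :* b :- (a :* a :+ κb :* a :* c :+ c :* c)))
      ≋-refl M κa κb κc a b c y) (ι 1ℤ ·₀ h ⊹ ι 1ℤ ·₀ ex))

  root-product : ∀ {y} → Markov M κa κb κc a b c → y + b + κa * c + κc * a ≋ M * a * c →
    y * b ≋ a * a + κb * a * c + c * c
  root-product {y} (mkMarkov h) s = by-combination
    (solve 8 (λ M κa κb κc a b c y →
      y :* b :- (a :* a :+ κb :* a :* c :+ c :* c) :=
      b :* (y :+ b :+ κa :* c :+ κc :* a :- M :* a :* c)
      :+ con (ℤ.- 1ℤ) :* (a :* a :+ b :* b :+ c :* c :+ κa :* b :* c :+ κb :* a :* c :+ κc :* a :* b :- M :* a :* b :* c))
      ≋-refl M κa κb κc a b c y) (b ·₀ s ⊹ ι (ℤ.- 1ℤ) ·₀ h)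

  Markov-vieta : ∀ {y} → Markov M κa κb κc a b c → y + b + κa * c + κc * a ≋ M * a * c →
    Markov M κa κb κc a y c
  Markov-vieta {y} (mkMarkov h) s = mkMarkov (by-combination
    (solve 8 (λ M κa κb κc a b c y →
      a :* a :+ y :* y :+ c :* c :+ κa :* y :* c :+ κb :* a :* c :+ κc :* a :* y :- M :* a :* y :* c :=
      (y :- b) :* (y :+ b :+ κa :* c :+ κc :* a :- M :* a :* c)
      :+ con 1ℤ :* (a :* a :+ b :* b :+ c :* c :+ κa :* b :* c :+ κb :* a :* c :+ κc :* a :* b :- M :* a :* b :* c))
      ≋-refl M κa κb κc a b c y) ((y - b) ·₀ s ⊹ ι 1ℤ ·₀ h))

-- Mutations of labelled triples

Labelled : Set
Labelled = Fin 3 → LP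

MarkovAt : K → S₃ → Labelled → Set
MarkovAt k ρ l = Markov (𝐌 k) (κ k (apply ρ 0F)) (κ k (apply ρ 1F)) (κ k (apply ρ 2F))
  (l (apply ρ 0F)) (l (apply ρ 1F)) (l (apply ρ 2F))

MarkovAt-from-id : ∀ {k} ρ {l} → MarkovAt k id l → MarkovAt k ρ l
MarkovAt-from-id id h = h
MarkovAt-from-id t12 h = Markov-swap₁₂ h
MarkovAt-from-id t23 h = Markov-swap₂₃ h
MarkovAt-from-id t13 h = Markov-swap₁₂ (Markov-swap₂₃ (Markov-swap₁₂ h))
MarkovAt-from-id c123 h = Markov-swap₂₃ (Markov-swap₁₂ h)
MarkovAt-from-id c132 h = Markov-swap₁₂ (Markov-swap₂₃ h)

exchange : K → Labelled → Fin 3 → LP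
exchange k l 0F = exchLP (kAt k 0F) (l 1F) (l 2F)
exchange k l 1F = exchLP (kAt k 1F) (l 0F) (l 2F)
exchange k l 2F = exchLP (kAt k 2F) (l 0F) (l 1F)

exchange-apply : ∀ k l ρ → exchange k l (apply ρ 1F) ≋ exchLP (kAt k (apply ρ 1F)) (l (apply ρ 0F)) (l (apply ρ 2F))
exchange-apply k l id = ≋-refl
exchange-apply k l t12 = ≋-refl
exchange-apply k l t23 = ≋-refl
exchange-apply k l t13 = exchLP-sym _ _ _
exchange-apply k l c123 = exchLP-sym _ _ _
exchange-apply k l c132 = exchLP-sym _ _ _

apply-≢₀₁ : ∀ ρ → apply ρ 0F ≢ apply ρ 1F
apply-≢₀₁ id ()
apply-≢₀₁ t12 ()
apply-≢₀₁ t13 ()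
apply-≢₀₁ t23 ()
apply-≢₀₁ c123 ()
apply-≢₀₁ c132 ()

apply-≢₂₁ : ∀ ρ → apply ρ 2F ≢ apply ρ 1F
apply-≢₂₁ id ()
apply-≢₂₁ t12 ()
apply-≢₂₁ t13 ()
apply-≢₂₁ t23 ()
apply-≢₂₁ c123 ()
apply-≢₂₁ c132 ()

inverse : S₃ → S₃
inverse id = id
inverse t12 = t12
inverse t13 = t13
inverse t23 = t23
inverse c123 = c132
inverse c132 = c123

apply-inverse : ∀ ρ i → apply ρ (apply (inverse ρ) i) ≡ i
apply-inverse id _ = refl
apply-inverse t12 0F = refl
apply-inverse t12 1F = refl
apply-inverse t12 2F = refl
apply-inverse t13 0F = refl
apply-inverse t13 1F = refl
apply-inverse t13 2F = refl
apply-inverse t23 0F = refl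
apply-inverse t23 1F = refl
apply-inverse t23 2F = refl
apply-inverse c123 0F = refl
apply-inverse c123 1F = refl
apply-inverse c123 2F = refl
apply-inverse c132 0F = refl
apply-inverse c132 1F = refl
apply-inverse c132 2F = refl

apply-cover : ∀ ρ i → i ≢ apply ρ 1F → i ≡ apply ρ 0F ⊎ i ≡ apply ρ 2F
apply-cover ρ i i≢ with apply (inverse ρ) i | apply-inverse ρ i
... | 0F | h = inj₁ (sym h)
... | 1F | h = ⊥-elim (i≢ (sym h))
... | 2F | h = inj₂ (sym h)

-- Presents two distinct positions as values of one permutation, so that a single argument in the
-- order of ρ covers all cases.
permutation-with : ∀ i j → i ≢ j → Σ S₃ λ ρ → apply ρ 0F ≡ i × apply ρ 1F ≡ j
permutation-with 0F 0F i≢j = ⊥-elim (i≢j refl)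
permutation-with 0F 1F _ = id , refl , refl
permutation-with 0F 2F _ = t23 , refl , refl
permutation-with 1F 0F _ = t12 , refl , refl
permutation-with 1F 1F i≢j = ⊥-elim (i≢j refl)
permutation-with 1F 2F _ = c123 , refl , refl
permutation-with 2F 0F _ = c132 , refl , refl
permutation-with 2F 1F _ = t13 , refl , refl
permutation-with 2F 2F i≢j = ⊥-elim (i≢j refl)

permutation-at : ∀ j → Σ S₃ λ ρ → apply ρ 1F ≡ j
permutation-at 0F = t12 , refl
permutation-at 1F = id , refl
permutation-at 2F = t23 , refl

record Mutation (k : K) (i : Fin 3) (l l′ : Labelled) : Set where
  field
    off : ∀ j → j ≢ i → l j ≋ l′ j
    on : l′ i * l i ≋ exchange k l i
open Mutation

exchange-cong : ∀ k i {l l′} → (∀ j → j ≢ i → l j ≋ l′ j) → exchange k l i ≋ exchange k l′ i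
exchange-cong k 0F h = exchLP-cong _ (h 1F λ ()) (h 2F λ ())
exchange-cong k 1F h = exchLP-cong _ (h 0F λ ()) (h 2F λ ())
exchange-cong k 2F h = exchLP-cong _ (h 0F λ ()) (h 1F λ ())

Mutation-sym : ∀ {k i l l′} → Mutation k i l l′ → Mutation k i l′ l
Mutation-sym {k} {i} {l} {l′} m = record
  { off = λ j j≢i → ≋-sym (off m j j≢i)
  ; on = ≋-trans (*-comm (l i) (l′ i)) (≋-trans (on m) (exchange-cong k i (off m))) }

Mutation-congʳ : ∀ {k i l l′ l″} → (∀ j → l′ j ≋ l″ j) → Mutation k i l l′ → Mutation k i l l″
Mutation-congʳ {i = i} h m = record
  { off = λ j j≢i → ≋-trans (off m j j≢i) (h j)
  ; on = ≋-trans (*-cong (≋-sym (h i)) ≋-refl) (on m) }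

-- Reduced paths to the initial cluster

StrictMax : Fin 3 → Labelled → Set
StrictMax i l = ∀ j → j ≢ i → ∣ l j ∣ ℤ.< ∣ l i ∣

StrictMax-cong : ∀ {i l l′} → (∀ j → l j ≋ l′ j) → StrictMax i l → StrictMax i l′
StrictMax-cong h mx j j≢i = subst₂ ℤ._<_ (∣∣-cong (h j)) (∣∣-cong (h _)) (mx j j≢i)

-- A reduced path to the initial cluster, always mutating the strictly largest variable; the index j,
-- at which l′ has its maximum, witnesses that the next mutation is at another position.
data Descent (k : K) : Labelled → Set where
  done : ∀ {l} → (∀ i → X i ≋ l i) → Descent k l
  down : ∀ {l l′} i j → j ≢ i → (∀ m → ∣ l′ m ∣ ℤ.≤ ∣ l′ j ∣) → StrictMax i l →
    Mutation k i l′ l → Descent k l′ → Descent k l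

Descent-cong : ∀ {k l l′} → (∀ j → l j ≋ l′ j) → Descent k l → Descent k l′
Descent-cong h (done e) = done (λ i → ≋-trans (e i) (h i))
Descent-cong h (down i j j≢i big mx m d) = down i j j≢i big (StrictMax-cong h mx) (Mutation-congʳ h m) d

Positive : Labelled → Set
Positive l = ∀ i → 0ℤ ℤ.< ∣ l i ∣

mutation-max : ∀ {k i j l l′} → Mutation k j l l′ → Positive l → i ≢ j →
  (∀ m → ∣ l m ∣ ℤ.≤ ∣ l i ∣) → StrictMax j l′
mutation-max {k} {i} {j} {l} {l′} mu pos i≢j big with permutation-with i j i≢j
... | ρ , refl , refl = strict
  where
  grown : ∣ l (apply ρ 0F) ∣ ℤ.< ∣ l′ (apply ρ 1F) ∣
  grown = exchange-grows (kAt k (apply ρ 1F)) (∣exchange∣ _ (≋-trans (on mu) (exchange-apply k l ρ)))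
    (pos _) (big _) (pos (apply ρ 2F))
  strict : StrictMax (apply ρ 1F) l′
  strict m m≢ = ℤP.≤-<-trans (subst (ℤ._≤ ∣ l (apply ρ 0F) ∣) (∣∣-cong (off mu m m≢)) (big m)) grown

-- A mutation at the position of the strict maximum undoes the last step of the path, because the
-- exchanged variable is unique in a domain. At any other position it creates a new strict maximum
-- and so lengthens the path.
mutation-descent : ∀ {k i l l′} → Mutation k i l l′ → Positive l → Descent k l → Descent k l′
mutation-descent {k} {i} {l} {l′} mu pos d@(done e) =
  down i (other i) (other≢ i) flat (mutation-max mu pos (other≢ i) flat) mu d
  where
  -- All initial values are 1, so any position different from i is a maximum and can serve as
  -- witness.
  other : Fin 3 → Fin 3
  other 0F = 1F
  other (suc _) = 0F
  other≢ : ∀ i → other i ≢ i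
  other≢ 0F ()
  other≢ (suc _) ()
  unit : ∀ m → ∣ l m ∣ ≡ 1ℤ
  unit m = trans (sym (∣∣-cong (e m))) (∣∣-X m)
  flat : ∀ m → ∣ l m ∣ ℤ.≤ ∣ l (other i) ∣
  flat m = ℤP.≤-reflexive (trans (unit m) (sym (unit _)))
mutation-descent {k} {i} {l} {l′} mu pos d@(down {l′ = l₀} j _ _ _ mx m₀ d₀) with j ≟ i
... | no j≢i = down i j j≢i big (mutation-max mu pos j≢i big) mu d
  where
  big : ∀ m → ∣ l m ∣ ℤ.≤ ∣ l j ∣
  big m with m ≟ j
  ... | yes refl = ℤP.≤-refl
  ... | no m≢j = ℤP.<⇒≤ (mx m m≢j)
... | yes refl = Descent-cong back d₀
  where
  back : ∀ m → l₀ m ≋ l′ m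
  back m with m ≟ j
  ... | no m≢j = ≋-trans (off m₀ m m≢j) (off mu m m≢j)
  ... | yes refl = *-cancelʳ (l m) (0<∣∣⇒nonzero (pos m)) (≋-trans (on (Mutation-sym m₀)) (≋-sym (on mu)))

-- The invariants carried through mutation; the matrix arguments know clusters only through them.
record IsCluster (k : K) (l : Labelled) : Set where
  field
    markov : MarkovAt k id l
    positive : Positive l
    parity : ∀ i → HasParity (l i) i
    descent : Descent k l
open IsCluster

IsCluster-cong : ∀ {k l l′} → (∀ j → l j ≋ l′ j) → IsCluster k l → IsCluster k l′
IsCluster-cong h c = record
  { markov = Markov-cong (h 0F) (h 1F) (h 2F) (markov c)
  ; positive = λ i → subst (0ℤ ℤ.<_) (∣∣-cong (h i)) (positive c i)
  ; parity = λ i → HasParity-cong (h i) (parity c i)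
  ; descent = Descent-cong h (descent c) }

mutation-markov : ∀ {k i l l′} → Mutation k i l l′ → Positive l → MarkovAt k id l → MarkovAt k id l′
mutation-markov {k} {i} {l} {l′} mu pos h with permutation-at i
... | ρ , refl = back ρ (Markov-cong (off mu _ (apply-≢₀₁ ρ)) ≋-refl (off mu _ (apply-≢₂₁ ρ))
    (Markov-vieta hρ (root-sum hρ (0<∣∣⇒nonzero (pos _)) (≋-trans (on mu) (exchange-apply k l ρ)))))
  where
  hρ = MarkovAt-from-id ρ {l} h
  back : ∀ ρ → MarkovAt k ρ l′ → MarkovAt k id l′
  back id h = h
  back t12 h = Markov-swap₁₂ h
  back t23 h = Markov-swap₂₃ h
  back t13 h = Markov-swap₁₂ (Markov-swap₂₃ (Markov-swap₁₂ h))
  back c123 h = Markov-swap₁₂ (Markov-swap₂₃ h)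
  back c132 h = Markov-swap₂₃ (Markov-swap₁₂ h)

mutation-positive : ∀ {k i l l′} → Mutation k i l l′ → Positive l → Positive l′
mutation-positive {k} {i} {l} mu pos j with j ≟ i
... | no j≢i = subst (0ℤ ℤ.<_) (∣∣-cong (off mu j j≢i)) (pos j)
... | yes refl with permutation-at j
...   | ρ , refl = positive-factor (pos _) (subst (0ℤ ℤ.<_)
        (sym (∣exchange∣ (kAt k (apply ρ 1F)) (≋-trans (on mu) (exchange-apply k l ρ))))
        (exchℤ-positive (kAt k (apply ρ 1F)) (ℤP.<⇒≤ (pos _)) (ℤP.<⇒≤ (pos (apply ρ 2F))) (inj₂ (pos _))))

mutation-cluster : ∀ {k i l l′} → Mutation k i l l′ → IsCluster k l → IsCluster k l′
mutation-cluster {k} {i} {l} {l′} mu c = record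
  { markov = mutation-markov mu (positive c) (markov c)
  ; positive = mutation-positive mu (positive c)
  ; parity = par′
  ; descent = mutation-descent mu (positive c) (descent c) }
  where
  par′ : ∀ j → HasParity (l′ j) j
  par′ j with j ≟ i
  ... | no j≢i = HasParity-cong (off mu j j≢i) (parity c j)
  ... | yes refl with permutation-at j
  ...   | ρ , refl = HasParity-exchange (kAt k (apply ρ 1F)) (apply ρ 1F) (≋-trans (on mu) (exchange-apply k l ρ))
          (parity c _) (parity c (apply ρ 0F)) (parity c (apply ρ 2F))

opaque
  unfolding _+_ _*_ ι 𝐌

  𝐌-def : ∀ k → 𝐌 k ≋ (X 0F * X 0F + X 1F * X 1F + X 2F * X 2F + κ k 0F * X 1F * X 2F + κ k 1F * X 0F * X 2F
    + κ k 2F * X 0F * X 1F) * Xinv 0F * Xinv 1F * Xinv 2F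
  𝐌-def k = ≋-refl

𝐌-clear : ∀ k → X 0F * X 0F + X 1F * X 1F + X 2F * X 2F + κ k 0F * X 1F * X 2F + κ k 1F * X 0F * X 2F
    + κ k 2F * X 0F * X 1F ≋ 𝐌 k * X 0F * X 1F * X 2F
𝐌-clear k = clear (X*Xinv 0F) (X*Xinv 1F) (X*Xinv 2F) (𝐌-def k)
  where
  clear : ∀ {M N x y z x′ y′ z′} → x * x′ ≋ ι 1ℤ → y * y′ ≋ ι 1ℤ → z * z′ ≋ ι 1ℤ →
    M ≋ N * x′ * y′ * z′ → N ≋ M * x * y * z
  clear {M} {N} {x} {y} {z} {x′} {y′} {z′} hx hy hz hM = by-combination
    (solve 8 (λ M N x y z x′ y′ z′ → N :- M :* x :* y :* z :=
      (:- N) :* (x :* x′ :- con 1ℤ) :+ ((:- (N :* x :* x′)) :* (y :* y′ :- con 1ℤ)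
       :+ ((:- (N :* x :* x′ :* y :* y′)) :* (z :* z′ :- con 1ℤ)
       :+ (:- (x :* y :* z)) :* (M :- N :* x′ :* y′ :* z′)))) ≋-refl M N x y z x′ y′ z′)
    ((- N) ·₀ hx ⊹ (- (N * x * x′)) ·₀ hy ⊹ (- (N * x * x′ * y * y′)) ·₀ hz ⊹ (- (x * y * z)) ·₀ hM)

initial-cluster : ∀ k → IsCluster k X
initial-cluster k = record
  { markov = mkMarkov (𝐌-clear k)
  ; positive = λ i → subst (0ℤ ℤ.<_) (sym (∣∣-X i)) (ℤ.+<+ (ℕ.s≤s ℕ.z≤n))
  ; parity = HasParity-X
  ; descent = done λ i → ≋-refl }

opaque
  unfolding _+_ _*_ ι

  mutation₁ : ∀ k {a b c a′} → a′ ⊗ a ≈ b ⊗ b ⊕ ⟪ kAt k 0F ⟫ ⊗ b ⊗ c ⊕ c ⊗ c →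
    Mutation k 0F (get (a , b , c)) (get (a′ , b , c))
  mutation₁ k h = record { off = λ { 0F 0≢0 → ⊥-elim (0≢0 refl) ; 1F _ → ≋-refl ; 2F _ → ≋-refl } ; on = mk≋ h }

  mutation₂ : ∀ k {a b c b′} → b′ ⊗ b ≈ a ⊗ a ⊕ ⟪ kAt k 1F ⟫ ⊗ a ⊗ c ⊕ c ⊗ c →
    Mutation k 1F (get (a , b , c)) (get (a , b′ , c))
  mutation₂ k h = record { off = λ { 0F _ → ≋-refl ; 1F 1≢1 → ⊥-elim (1≢1 refl) ; 2F _ → ≋-refl } ; on = mk≋ h }

  mutation₃ : ∀ k {a b c c′} → c′ ⊗ c ≈ a ⊗ a ⊕ ⟪ kAt k 2F ⟫ ⊗ a ⊗ b ⊕ b ⊗ b →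
    Mutation k 2F (get (a , b , c)) (get (a , b , c′))
  mutation₃ k h = record { off = λ { 0F _ → ≋-refl ; 1F _ → ≋-refl ; 2F 2≢2 → ⊥-elim (2≢2 refl) } ; on = mk≋ h }

labeled⇒cluster : ∀ {k t} → LabeledCluster k t → IsCluster k (get t)
labeled⇒cluster {k} initial = IsCluster-cong (λ { 0F → ≋-refl ; 1F → ≋-refl ; 2F → ≋-refl }) (initial-cluster k)
labeled⇒cluster {k} (mut₁ c h) = mutation-cluster (mutation₁ k h) (labeled⇒cluster c)
labeled⇒cluster {k} (mut₂ c h) = mutation-cluster (mutation₂ k h) (labeled⇒cluster c)
labeled⇒cluster {k} (mut₃ c h) = mutation-cluster (mutation₃ k h) (labeled⇒cluster c)
labeled⇒cluster (resp c (aa , bb , cc)) =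
  IsCluster-cong (λ { 0F → mk≋ aa ; 1F → mk≋ bb ; 2F → mk≋ cc }) (labeled⇒cluster c)

-- Cohn matrices and triples

record _≋ₘ_ (P Q : M₂) : Set where
  constructor mk≋ₘ
  field
    ≋₁₁ : m₁₁ P ≋ m₁₁ Q
    ≋₁₂ : m₁₂ P ≋ m₁₂ Q
    ≋₂₁ : m₂₁ P ≋ m₂₁ Q
    ≋₂₂ : m₂₂ P ≋ m₂₂ Q
open _≋ₘ_

≋ₘ-refl : ∀ {P} → P ≋ₘ P
≋ₘ-refl = mk≋ₘ ≋-refl ≋-refl ≋-refl ≋-refl

≋ₘ-sym : ∀ {P Q} → P ≋ₘ Q → Q ≋ₘ P
≋ₘ-sym (mk≋ₘ a b c d) = mk≋ₘ (≋-sym a) (≋-sym b) (≋-sym c) (≋-sym d)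

≋ₘ-trans : ∀ {P Q R} → P ≋ₘ Q → Q ≋ₘ R → P ≋ₘ R
≋ₘ-trans (mk≋ₘ a b c d) (mk≋ₘ a′ b′ c′ d′) =
  mk≋ₘ (≋-trans a a′) (≋-trans b b′) (≋-trans c c′) (≋-trans d d′)

-- Reflection in the antidiagonal: an anti-automorphism fixing the (1,2)-entry, which exchanges left and right.
flip : M₂ → M₂
flip (mat a b c d) = mat d b c a

flip-≋ : ∀ {P Q} → P ≋ₘ Q → flip P ≋ₘ flip Q
flip-≋ (mk≋ₘ a b c d) = mk≋ₘ d b c a

-- In terms of the linear form φ(A) = tr A - M a₁₂, the trace condition is φ(P) = -s. For N =
-- [[1,0],[M,1]] one has φ(N) = 2 and φ(P N) = tr P; the trace computations below rest on these two
-- values.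
record IsCohn (M s : LP) (P : M₂) : Set where
  constructor mkCohn
  field
    unimodular : m₁₁ P * m₂₂ P - m₁₂ P * m₂₁ P ≋ ι 1ℤ
    trace : m₁₁ P + m₂₂ P ≋ M * m₁₂ P - s
open IsCohn

IsCohn-flip : ∀ {M s P} → IsCohn M s P → IsCohn M s (flip P)
IsCohn-flip {P = mat a b c d} (mkCohn u t) =
  mkCohn (≋-trans (+-cong (*-comm d a) ≋-refl) u) (≋-trans (+-comm d a) t)

IsCohn-cong : ∀ {M s P Q} → P ≋ₘ Q → IsCohn M s P → IsCohn M s Q
IsCohn-cong (mk≋ₘ a b c d) (mkCohn u t) =
  mkCohn (≋-trans (≋-sym (+-cong (*-cong a d) (neg-cong (*-cong b c)))) u)
         (≋-trans (≋-sym (+-cong a d)) (≋-trans t (+-cong (*-cong ≋-refl b) ≋-refl)))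

-- The trace yields the (2,2)-entry; the determinant then yields the (2,1)-entry after cancelling
-- p₁₂.
IsCohn-determined : ∀ {M s P Q} → ¬ m₁₂ P ≋ ι 0ℤ → IsCohn M s P → IsCohn M s Q →
  m₁₁ P ≋ m₁₁ Q → m₁₂ P ≋ m₁₂ Q → P ≋ₘ Q
IsCohn-determined {M} {s} {mat a b c d} {mat a′ b′ c′ d′} b≢0 (mkCohn u t) (mkCohn u′ t′) aa bb =
  mk≋ₘ aa bb cc dd
  where
  dd : d ≋ d′
  dd = by-combination (solve 8 (λ M s a b d a′ b′ d′ → d :- d′ :=
      con 1ℤ :* (a :+ d :- (M :* b :- s)) :+ (con -1ℤ :* (a′ :+ d′ :- (M :* b′ :- s))
      :+ (con -1ℤ :* (a :- a′) :+ M :* (b :- b′)))) ≋-refl M s a b d a′ b′ d′)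
    (ι 1ℤ ·₀ t ⊹ ι -1ℤ ·₀ t′ ⊹ ι -1ℤ ·₀ aa ⊹ M ·₀ bb)
  cc : c ≋ c′
  cc = *-cancelʳ b b≢0 (by-combination (solve 8 (λ a b c d a′ b′ c′ d′ → c :* b :- c′ :* b :=
      con -1ℤ :* (a :* d :- b :* c :- con 1ℤ) :+ (con 1ℤ :* (a′ :* d′ :- b′ :* c′ :- con 1ℤ)
      :+ (d :* (a :- a′) :+ (a′ :* (d :- d′) :+ (:- c′) :* (b :- b′))))) ≋-refl a b c d a′ b′ c′ d′)
    (ι -1ℤ ·₀ u ⊹ ι 1ℤ ·₀ u′ ⊹ d ·₀ aa ⊹ a′ ·₀ dd ⊹ (- c′) ·₀ bb))

-- Q = P R − s N with N = [[1,0],[M,1]].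
record Product (M s : LP) (P Q R : M₂) : Set where
  constructor mkProduct
  field
    entry₁₁ : m₁₁ Q ≋ m₁₁ P * m₁₁ R + m₁₂ P * m₂₁ R - s
    entry₁₂ : m₁₂ Q ≋ m₁₁ P * m₁₂ R + m₁₂ P * m₂₂ R
    entry₂₁ : m₂₁ Q ≋ m₂₁ P * m₁₁ R + m₂₂ P * m₂₁ R - s * M
    entry₂₂ : m₂₂ Q ≋ m₂₁ P * m₁₂ R + m₂₂ P * m₂₂ R - s
open Product

Product-flip : ∀ {M s P Q R} → Product M s P Q R → Product M s (flip R) (flip Q) (flip P)
Product-flip {M} {s} {mat p₁ p₂ p₃ p₄} {_} {mat r₁ r₂ r₃ r₄} (mkProduct a b c d) = mkProduct
  (≋-trans d (+-cong (swap p₃ r₂ p₄ r₄) ≋-refl)) (≋-trans b (swap p₁ r₂ p₂ r₄))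
  (≋-trans c (+-cong (swap p₃ r₁ p₄ r₃) ≋-refl)) (≋-trans a (+-cong (swap p₁ r₁ p₂ r₃) ≋-refl))
  where
  swap : ∀ w x y z → w * x + y * z ≋ z * y + x * w
  swap = solve 4 (λ w x y z → w :* x :+ y :* z := z :* y :+ x :* w) ≋-refl

Product-unique : ∀ {M s P Q R P′ Q′ R′} → P ≋ₘ P′ → R ≋ₘ R′ → Product M s P Q R → Product M s P′ Q′ R′ → Q ≋ₘ Q′
Product-unique (mk≋ₘ p₁ p₂ p₃ p₄) (mk≋ₘ r₁ r₂ r₃ r₄) (mkProduct a b c d) (mkProduct a′ b′ c′ d′) = mk≋ₘ
  (≋-trans a (≋-trans (+-cong (+-cong (*-cong p₁ r₁) (*-cong p₂ r₃)) ≋-refl) (≋-sym a′)))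
  (≋-trans b (≋-trans (+-cong (*-cong p₁ r₂) (*-cong p₂ r₄)) (≋-sym b′)))
  (≋-trans c (≋-trans (+-cong (+-cong (*-cong p₃ r₁) (*-cong p₄ r₃)) ≋-refl) (≋-sym c′)))
  (≋-trans d (≋-trans (+-cong (+-cong (*-cong p₃ r₂) (*-cong p₄ r₄)) ≋-refl) (≋-sym d′)))

-- P⁻¹ (Q + s N), for P of determinant 1.
quotient : LP → LP → M₂ → M₂ → M₂
quotient M s (mat p₁ p₂ p₃ p₄) (mat q₁ q₂ q₃ q₄) = mat
  (p₄ * (q₁ + s) - p₂ * (q₃ + s * M)) (p₄ * q₂ - p₂ * (q₄ + s))
  (p₁ * (q₃ + s * M) - p₃ * (q₁ + s)) (p₁ * (q₄ + s) - p₃ * q₂)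

Product-quotient : ∀ {M s P} R → m₁₁ P * m₂₂ P - m₁₂ P * m₂₁ P ≋ ι 1ℤ → Product M s P R (quotient M s P R)
Product-quotient {M} {s} {mat p₁ p₂ p₃ p₄} (mat r₁ r₂ r₃ r₄) u = mkProduct
  (by-combination (solve 8 (λ M s p₁ p₂ p₃ p₄ r₁ r₃ →
      r₁ :- (p₁ :* (p₄ :* (r₁ :+ s) :- p₂ :* (r₃ :+ s :* M)) :+ p₂ :* (p₁ :* (r₃ :+ s :* M) :- p₃ :* (r₁ :+ s)) :- s)
      := (:- (r₁ :+ s)) :* (p₁ :* p₄ :- p₂ :* p₃ :- con 1ℤ)) ≋-refl M s p₁ p₂ p₃ p₄ r₁ r₃) ((- (r₁ + s)) ·₀ u))
  (by-combination (solve 7 (λ s p₁ p₂ p₃ p₄ r₂ r₄ →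
      r₂ :- (p₁ :* (p₄ :* r₂ :- p₂ :* (r₄ :+ s)) :+ p₂ :* (p₁ :* (r₄ :+ s) :- p₃ :* r₂))
      := (:- r₂) :* (p₁ :* p₄ :- p₂ :* p₃ :- con 1ℤ)) ≋-refl s p₁ p₂ p₃ p₄ r₂ r₄) ((- r₂) ·₀ u))
  (by-combination (solve 8 (λ M s p₁ p₂ p₃ p₄ r₁ r₃ →
      r₃ :- (p₃ :* (p₄ :* (r₁ :+ s) :- p₂ :* (r₃ :+ s :* M)) :+ p₄ :* (p₁ :* (r₃ :+ s :* M) :- p₃ :* (r₁ :+ s)) :- s :* M)
      := (:- (r₃ :+ s :* M)) :* (p₁ :* p₄ :- p₂ :* p₃ :- con 1ℤ)) ≋-refl M s p₁ p₂ p₃ p₄ r₁ r₃) ((- (r₃ + s * M)) ·₀ u))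
  (by-combination (solve 7 (λ s p₁ p₂ p₃ p₄ r₂ r₄ →
      r₄ :- (p₃ :* (p₄ :* r₂ :- p₂ :* (r₄ :+ s)) :+ p₄ :* (p₁ :* (r₄ :+ s) :- p₃ :* r₂) :- s)
      := (:- (r₄ :+ s)) :* (p₁ :* p₄ :- p₂ :* p₃ :- con 1ℤ)) ≋-refl s p₁ p₂ p₃ p₄ r₂ r₄) ((- (r₄ + s)) ·₀ u))

quotient-unique : ∀ {M s P Q R} → m₁₁ P * m₂₂ P - m₁₂ P * m₂₁ P ≋ ι 1ℤ → Product M s P Q R → R ≋ₘ quotient M s P Q
quotient-unique {M} {s} {mat p₁ p₂ p₃ p₄} {mat q₁ q₂ q₃ q₄} {mat r₁ r₂ r₃ r₄} u (mkProduct a b c d) = mk≋ₘ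
  (by-combination (solve 10 (λ M s p₁ p₂ p₃ p₄ q₁ q₃ r₁ r₃ → r₁ :- (p₄ :* (q₁ :+ s) :- p₂ :* (q₃ :+ s :* M)) :=
      (:- r₁) :* (p₁ :* p₄ :- p₂ :* p₃ :- con 1ℤ) :+ ((:- p₄) :* (q₁ :- (p₁ :* r₁ :+ p₂ :* r₃ :- s))
      :+ p₂ :* (q₃ :- (p₃ :* r₁ :+ p₄ :* r₃ :- s :* M)))) ≋-refl M s p₁ p₂ p₃ p₄ q₁ q₃ r₁ r₃)
    ((- r₁) ·₀ u ⊹ (- p₄) ·₀ a ⊹ p₂ ·₀ c))
  (by-combination (solve 9 (λ s p₁ p₂ p₃ p₄ q₂ q₄ r₂ r₄ → r₂ :- (p₄ :* q₂ :- p₂ :* (q₄ :+ s)) :=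
      (:- r₂) :* (p₁ :* p₄ :- p₂ :* p₃ :- con 1ℤ) :+ ((:- p₄) :* (q₂ :- (p₁ :* r₂ :+ p₂ :* r₄))
      :+ p₂ :* (q₄ :- (p₃ :* r₂ :+ p₄ :* r₄ :- s)))) ≋-refl s p₁ p₂ p₃ p₄ q₂ q₄ r₂ r₄)
    ((- r₂) ·₀ u ⊹ (- p₄) ·₀ b ⊹ p₂ ·₀ d))
  (by-combination (solve 10 (λ M s p₁ p₂ p₃ p₄ q₁ q₃ r₁ r₃ → r₃ :- (p₁ :* (q₃ :+ s :* M) :- p₃ :* (q₁ :+ s)) :=
      (:- r₃) :* (p₁ :* p₄ :- p₂ :* p₃ :- con 1ℤ) :+ (p₃ :* (q₁ :- (p₁ :* r₁ :+ p₂ :* r₃ :- s))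
      :+ (:- p₁) :* (q₃ :- (p₃ :* r₁ :+ p₄ :* r₃ :- s :* M)))) ≋-refl M s p₁ p₂ p₃ p₄ q₁ q₃ r₁ r₃)
    ((- r₃) ·₀ u ⊹ p₃ ·₀ a ⊹ (- p₁) ·₀ c))
  (by-combination (solve 9 (λ s p₁ p₂ p₃ p₄ q₂ q₄ r₂ r₄ → r₄ :- (p₁ :* (q₄ :+ s) :- p₃ :* q₂) :=
      (:- r₄) :* (p₁ :* p₄ :- p₂ :* p₃ :- con 1ℤ) :+ (p₃ :* (q₂ :- (p₁ :* r₂ :+ p₂ :* r₄))
      :+ (:- p₁) :* (q₄ :- (p₃ :* r₂ :+ p₄ :* r₄ :- s)))) ≋-refl s p₁ p₂ p₃ p₄ q₂ q₄ r₂ r₄)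
    ((- r₄) ·₀ u ⊹ p₃ ·₀ b ⊹ (- p₁) ·₀ d))

quotient-cong : ∀ {M s s′ P Q P′ Q′} → s ≋ s′ → P ≋ₘ P′ → Q ≋ₘ Q′ → quotient M s P Q ≋ₘ quotient M s′ P′ Q′
quotient-cong ss (mk≋ₘ p₁ p₂ p₃ p₄) (mk≋ₘ q₁ q₂ q₃ q₄) = mk≋ₘ
  (+-cong (*-cong p₄ (+-cong q₁ ss)) (neg-cong (*-cong p₂ (+-cong q₃ (*-cong ss ≋-refl)))))
  (+-cong (*-cong p₄ q₂) (neg-cong (*-cong p₂ (+-cong q₄ ss))))
  (+-cong (*-cong p₁ (+-cong q₃ (*-cong ss ≋-refl))) (neg-cong (*-cong p₃ (+-cong q₁ ss))))
  (+-cong (*-cong p₁ (+-cong q₄ ss)) (neg-cong (*-cong p₃ q₂)))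

-- Triples, their children and their parents

record CohnTriple (M κp κq κr : LP) (P Q R : M₂) : Set where
  constructor mkTriple
  field
    cohnP : IsCohn M κp P
    cohnQ : IsCohn M κq Q
    cohnR : IsCohn M κr R
    product : Product M κq P Q R
    markovian : Markov M κp κq κr (m₁₂ P) (m₁₂ Q) (m₁₂ R)
open CohnTriple

CohnTriple-flip : ∀ {M κp κq κr P Q R} → CohnTriple M κp κq κr P Q R → CohnTriple M κr κq κp (flip R) (flip Q) (flip P)
CohnTriple-flip (mkTriple p q r h m) = mkTriple (IsCohn-flip r) (IsCohn-flip q) (IsCohn-flip p) (Product-flip h)
  (Markov-swap₁₂ (Markov-swap₂₃ (Markov-swap₁₂ m)))

-- The matrix Q + s N = P R has determinant 1, and det(Q + s N) = det Q + s (tr Q - M q₁₂ + s). The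
-- correction vanishes exactly by the trace condition.
Product-unimodular : ∀ {M s P Q R} → m₁₁ P * m₂₂ P - m₁₂ P * m₂₁ P ≋ ι 1ℤ → m₁₁ R * m₂₂ R - m₁₂ R * m₂₁ R ≋ ι 1ℤ →
  Product M s P Q R → m₁₁ Q + m₂₂ Q ≋ M * m₁₂ Q - s → m₁₁ Q * m₂₂ Q - m₁₂ Q * m₂₁ Q ≋ ι 1ℤ
Product-unimodular {M} {s} {mat p₁ p₂ p₃ p₄} {mat q₁ q₂ q₃ q₄} {mat r₁ r₂ r₃ r₄} u v (mkProduct a b c d) t =
  by-combination (solve 14 (λ M s p₁ p₂ p₃ p₄ q₁ q₂ q₃ q₄ r₁ r₂ r₃ r₄ →
      q₁ :* q₄ :- q₂ :* q₃ :- con 1ℤ :=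
      (r₁ :* r₄ :- r₂ :* r₃) :* (p₁ :* p₄ :- p₂ :* p₃ :- con 1ℤ) :+ (con 1ℤ :* (r₁ :* r₄ :- r₂ :* r₃ :- con 1ℤ)
      :+ ((q₄ :+ s) :* (q₁ :- (p₁ :* r₁ :+ p₂ :* r₃ :- s))
      :+ ((:- (q₃ :+ s :* M)) :* (q₂ :- (p₁ :* r₂ :+ p₂ :* r₄))
      :+ ((:- (p₁ :* r₂ :+ p₂ :* r₄)) :* (q₃ :- (p₃ :* r₁ :+ p₄ :* r₃ :- s :* M))
      :+ ((p₁ :* r₁ :+ p₂ :* r₃) :* (q₄ :- (p₃ :* r₂ :+ p₄ :* r₄ :- s))
      :+ (:- s) :* (q₁ :+ q₄ :- (M :* q₂ :- s))))))))
      ≋-refl M s p₁ p₂ p₃ p₄ q₁ q₂ q₃ q₄ r₁ r₂ r₃ r₄)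
    ((r₁ * r₄ - r₂ * r₃) ·₀ u ⊹ ι 1ℤ ·₀ v ⊹ (q₄ + s) ·₀ a ⊹ (- (q₃ + s * M)) ·₀ b ⊹ (- (p₁ * r₂ + p₂ * r₄)) ·₀ c
      ⊹ (p₁ * r₁ + p₂ * r₃) ·₀ d ⊹ (- s) ·₀ t)

-- The trace of a product is read off from the Markov equation after multiplication by p₁₂ r₁₂.
Product-trace : ∀ {M s κp κr P Q R} → ¬ m₁₂ P * m₁₂ R ≋ ι 0ℤ → IsCohn M κp P → IsCohn M κr R → Product M s P Q R →
  Markov M κp s κr (m₁₂ P) (m₁₂ Q) (m₁₂ R) → m₁₁ Q + m₂₂ Q ≋ M * m₁₂ Q - s
Product-trace {M} {s} {κp} {κr} {mat p₁ p₂ p₃ p₄} {mat q₁ q₂ q₃ q₄} {mat r₁ r₂ r₃ r₄}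
  nz (mkCohn u tp) (mkCohn v tr) (mkProduct a b c d) (mkMarkov m) =
  *-cancelʳ (p₂ * r₂) nz (by-combination (solve 15 (λ M s κp κr p₁ p₂ p₃ p₄ q₁ q₂ q₄ r₁ r₂ r₃ r₄ →
      (q₁ :+ q₄) :* (p₂ :* r₂) :- (M :* q₂ :- s) :* (p₂ :* r₂) :=
      (:- (r₂ :* r₂)) :* (p₁ :* p₄ :- p₂ :* p₃ :- con 1ℤ) :+ ((:- (p₂ :* p₂)) :* (r₁ :* r₄ :- r₂ :* r₃ :- con 1ℤ)
      :+ ((p₂ :* r₂) :* (q₁ :- (p₁ :* r₁ :+ p₂ :* r₃ :- s))
      :+ ((q₂ :- (p₂ :* r₁ :+ r₂ :* p₄)) :* (q₂ :- (p₁ :* r₂ :+ p₂ :* r₄))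
      :+ ((p₂ :* r₂) :* (q₄ :- (p₃ :* r₂ :+ p₄ :* r₄ :- s))
      :+ ((q₂ :* r₂) :* (p₁ :+ p₄ :- (M :* p₂ :- κp))
      :+ ((p₂ :* q₂) :* (r₁ :+ r₄ :- (M :* r₂ :- κr))
      :+ con -1ℤ :* (p₂ :* p₂ :+ q₂ :* q₂ :+ r₂ :* r₂ :+ κp :* q₂ :* r₂ :+ s :* p₂ :* r₂ :+ κr :* p₂ :* q₂
           :- M :* p₂ :* q₂ :* r₂))))))))
      ≋-refl M s κp κr p₁ p₂ p₃ p₄ q₁ q₂ q₄ r₁ r₂ r₃ r₄)
    ((- (r₂ * r₂)) ·₀ u ⊹ (- (p₂ * p₂)) ·₀ v ⊹ (p₂ * r₂) ·₀ a ⊹ (q₂ - (p₂ * r₁ + r₂ * p₄)) ·₀ b ⊹ (p₂ * r₂) ·₀ d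
      ⊹ (q₂ * r₂) ·₀ tp ⊹ (p₂ * q₂) ·₀ tr ⊹ ι -1ℤ ·₀ m))

module _ {M κp κq κr : LP} {P Q R : M₂} (T : CohnTriple M κp κq κr P Q R) where

  module _ {Y : M₂} (h : Product M κr P Y Q) where

    -- Cayley-Hamilton gives P Q = P² R - κq P N = tr P (Q + κq N) - R - κq P N. The claim is its
    -- (1,2)-entry, with tr P = M p₁₂ - κp inserted.
    child-root-sum : m₁₂ Y + m₁₂ R + κp * m₁₂ Q + κq * m₁₂ P ≋ M * m₁₂ P * m₁₂ Q
    child-root-sum = go T h
      where
      go : ∀ {P Q R Y} → CohnTriple M κp κq κr P Q R → Product M κr P Y Q →
        m₁₂ Y + m₁₂ R + κp * m₁₂ Q + κq * m₁₂ P ≋ M * m₁₂ P * m₁₂ Q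
      go {mat p₁ p₂ p₃ p₄} {mat q₁ q₂ q₃ q₄} {mat r₁ r₂ r₃ r₄} {mat y₁ y₂ y₃ y₄}
        (mkTriple (mkCohn u tp) _ _ (mkProduct _ b _ d) _) (mkProduct _ b′ _ _) =
        by-combination (solve 12 (λ M κp κq p₁ p₂ p₃ p₄ q₂ q₄ r₂ r₄ y₂ →
            y₂ :+ r₂ :+ κp :* q₂ :+ κq :* p₂ :- M :* p₂ :* q₂ :=
            con 1ℤ :* (y₂ :- (p₁ :* q₂ :+ p₂ :* q₄)) :+ (p₂ :* (q₄ :- (p₃ :* r₂ :+ p₄ :* r₄ :- κq))
            :+ ((:- r₂) :* (p₁ :* p₄ :- p₂ :* p₃ :- con 1ℤ) :+ ((:- p₄) :* (q₂ :- (p₁ :* r₂ :+ p₂ :* r₄))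
            :+ q₂ :* (p₁ :+ p₄ :- (M :* p₂ :- κp))))))
            ≋-refl M κp κq p₁ p₂ p₃ p₄ q₂ q₄ r₂ r₄ y₂)
          (ι 1ℤ ·₀ b′ ⊹ p₂ ·₀ d ⊹ (- r₂) ·₀ u ⊹ (- p₄) ·₀ b ⊹ q₂ ·₀ tp)

    -- Apply φ(A) = tr A - M a₁₂ to P Q = tr P (Q + κq N) - R - κq P N. The multiples of tr P
    -- cancel, leaving φ(P Q) = κr, and subtracting κr N gives φ(Y) = κr - 2κr.
    child-trace : m₁₁ Y + m₂₂ Y ≋ M * m₁₂ Y - κr
    child-trace = go T h
      where
      go : ∀ {P Q R Y} → CohnTriple M κp κq κr P Q R → Product M κr P Y Q → m₁₁ Y + m₂₂ Y ≋ M * m₁₂ Y - κr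
      go {mat p₁ p₂ p₃ p₄} {mat q₁ q₂ q₃ q₄} {mat r₁ r₂ r₃ r₄} {mat y₁ y₂ y₃ y₄}
        (mkTriple (mkCohn u _) (mkCohn _ tq) (mkCohn _ tr) (mkProduct a b c d) _) (mkProduct a′ b′ _ d′) =
        by-combination (solve 18 (λ M κq κr p₁ p₂ p₃ p₄ q₁ q₂ q₃ q₄ r₁ r₂ r₃ r₄ y₁ y₂ y₄ →
            y₁ :+ y₄ :- (M :* y₂ :- κr) :=
            con 1ℤ :* (y₁ :- (p₁ :* q₁ :+ p₂ :* q₃ :- κr)) :+ (con 1ℤ :* (y₄ :- (p₃ :* q₂ :+ p₄ :* q₄ :- κr))
            :+ ((:- M) :* (y₂ :- (p₁ :* q₂ :+ p₂ :* q₄))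
            :+ ((:- p₄) :* (q₁ :- (p₁ :* r₁ :+ p₂ :* r₃ :- κq))
            :+ (p₂ :* (q₃ :- (p₃ :* r₁ :+ p₄ :* r₃ :- κq :* M))
            :+ ((p₃ :+ M :* p₄) :* (q₂ :- (p₁ :* r₂ :+ p₂ :* r₄))
            :+ ((:- (p₁ :+ M :* p₂)) :* (q₄ :- (p₃ :* r₂ :+ p₄ :* r₄ :- κq))
            :+ ((p₁ :+ p₄) :* (q₁ :+ q₄ :- (M :* q₂ :- κq))
            :+ ((M :* r₂ :- (r₁ :+ r₄)) :* (p₁ :* p₄ :- p₂ :* p₃ :- con 1ℤ)
            :+ con -1ℤ :* (r₁ :+ r₄ :- (M :* r₂ :- κr)))))))))))
            ≋-refl M κq κr p₁ p₂ p₃ p₄ q₁ q₂ q₃ q₄ r₁ r₂ r₃ r₄ y₁ y₂ y₄)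
          (ι 1ℤ ·₀ a′ ⊹ ι 1ℤ ·₀ d′ ⊹ (- M) ·₀ b′ ⊹ (- p₄) ·₀ a ⊹ p₂ ·₀ c ⊹ (p₃ + M * p₄) ·₀ b ⊹ (- (p₁ + M * p₂)) ·₀ d
            ⊹ (p₁ + p₄) ·₀ tq ⊹ (M * r₂ - (r₁ + r₄)) ·₀ u ⊹ ι -1ℤ ·₀ tr)

    left-triple : CohnTriple M κp κr κq P Y Q
    left-triple = mkTriple (cohnP T)
      (mkCohn (Product-unimodular (unimodular (cohnP T)) (unimodular (cohnQ T)) h child-trace) child-trace)
      (cohnQ T) h (Markov-vieta (Markov-swap₂₃ (markovian T)) child-root-sum)

    child-exchange : m₁₂ Y * m₁₂ R ≋ m₁₂ P * m₁₂ P + κr * m₁₂ P * m₁₂ Q + m₁₂ Q * m₁₂ Q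
    child-exchange = root-product (Markov-swap₂₃ (markovian T)) child-root-sum

  -- Since P⁻¹ = tr P - P, the (1,2)-entry of P⁻¹(R + κr N) is tr P r₁₂ - q₁₂ - κr p₁₂.
  left-parent-root-sum : m₁₂ (quotient M κr P R) + m₁₂ Q + κp * m₁₂ R + κr * m₁₂ P ≋ M * m₁₂ P * m₁₂ R
  left-parent-root-sum = go T
    where
    go : ∀ {P Q R} → CohnTriple M κp κq κr P Q R →
      m₁₂ (quotient M κr P R) + m₁₂ Q + κp * m₁₂ R + κr * m₁₂ P ≋ M * m₁₂ P * m₁₂ R
    go {mat p₁ p₂ p₃ p₄} {mat q₁ q₂ q₃ q₄} {mat r₁ r₂ r₃ r₄} (mkTriple (mkCohn _ tp) _ _ (mkProduct _ b _ _) _) =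
      by-combination (solve 9 (λ M κp κr p₁ p₂ p₄ q₂ r₂ r₄ →
          p₄ :* r₂ :- p₂ :* (r₄ :+ κr) :+ q₂ :+ κp :* r₂ :+ κr :* p₂ :- M :* p₂ :* r₂ :=
          con 1ℤ :* (q₂ :- (p₁ :* r₂ :+ p₂ :* r₄)) :+ r₂ :* (p₁ :+ p₄ :- (M :* p₂ :- κp)))
          ≋-refl M κp κr p₁ p₂ p₄ q₂ r₂ r₄)
        (ι 1ℤ ·₀ b ⊹ r₂ ·₀ tp)

  -- As in `Product-unimodular`, adding κr N to R preserves its determinant. For the trace, P⁻¹ = tr
  -- P - P gives φ = tr P (φ(R) + 2κr) - φ(P R) - κr tr P, where φ(R) = -κr and φ(P R) = φ(Q) + 2κq
  -- = κq.
  left-parent-cohn : IsCohn M κq (quotient M κr P R)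
  left-parent-cohn = go T
    where
    go : ∀ {P Q R} → CohnTriple M κp κq κr P Q R → IsCohn M κq (quotient M κr P R)
    go {mat p₁ p₂ p₃ p₄} {mat q₁ q₂ q₃ q₄} {mat r₁ r₂ r₃ r₄}
      (mkTriple (mkCohn u _) (mkCohn _ tq) (mkCohn v tr) (mkProduct a b _ d) _) = mkCohn
      (by-combination (solve 10 (λ M κr p₁ p₂ p₃ p₄ r₁ r₂ r₃ r₄ →
          (p₄ :* (r₁ :+ κr) :- p₂ :* (r₃ :+ κr :* M)) :* (p₁ :* (r₄ :+ κr) :- p₃ :* r₂)
          :- (p₄ :* r₂ :- p₂ :* (r₄ :+ κr)) :* (p₁ :* (r₃ :+ κr :* M) :- p₃ :* (r₁ :+ κr)) :- con 1ℤ :=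
          ((r₁ :+ κr) :* (r₄ :+ κr) :- r₂ :* (r₃ :+ κr :* M)) :* (p₁ :* p₄ :- p₂ :* p₃ :- con 1ℤ)
          :+ (con 1ℤ :* (r₁ :* r₄ :- r₂ :* r₃ :- con 1ℤ) :+ κr :* (r₁ :+ r₄ :- (M :* r₂ :- κr))))
          ≋-refl M κr p₁ p₂ p₃ p₄ r₁ r₂ r₃ r₄)
        (((r₁ + κr) * (r₄ + κr) - r₂ * (r₃ + κr * M)) ·₀ u ⊹ ι 1ℤ ·₀ v ⊹ κr ·₀ tr))
      (by-combination (solve 14 (λ M κq κr p₁ p₂ p₃ p₄ q₁ q₂ q₄ r₁ r₂ r₃ r₄ →
          p₄ :* (r₁ :+ κr) :- p₂ :* (r₃ :+ κr :* M) :+ (p₁ :* (r₄ :+ κr) :- p₃ :* r₂)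
          :- (M :* (p₄ :* r₂ :- p₂ :* (r₄ :+ κr)) :- κq) :=
          (p₁ :+ p₄) :* (r₁ :+ r₄ :- (M :* r₂ :- κr)) :+ (con -1ℤ :* (q₁ :+ q₄ :- (M :* q₂ :- κq))
          :+ (con 1ℤ :* (q₁ :- (p₁ :* r₁ :+ p₂ :* r₃ :- κq)) :+ (con 1ℤ :* (q₄ :- (p₃ :* r₂ :+ p₄ :* r₄ :- κq))
          :+ (:- M) :* (q₂ :- (p₁ :* r₂ :+ p₂ :* r₄))))))
          ≋-refl M κq κr p₁ p₂ p₃ p₄ q₁ q₂ q₄ r₁ r₂ r₃ r₄)
        ((p₁ + p₄) ·₀ tr ⊹ ι -1ℤ ·₀ tq ⊹ ι 1ℤ ·₀ a ⊹ ι 1ℤ ·₀ d ⊹ (- M) ·₀ b))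

  left-parent : CohnTriple M κp κr κq P R (quotient M κr P R)
  left-parent = mkTriple (cohnP T) (cohnR T) left-parent-cohn (Product-quotient R (unimodular (cohnP T)))
    (Markov-swap₂₃ (Markov-vieta (markovian T) left-parent-root-sum))

  left-parent-exchange : m₁₂ (quotient M κr P R) * m₁₂ Q ≋ m₁₂ P * m₁₂ P + κq * m₁₂ P * m₁₂ R + m₁₂ R * m₁₂ R
  left-parent-exchange = root-product (markovian T) left-parent-root-sum

opaque
  unfolding _+_ _*_ -_ ι 𝐌

  CGC⇒IsCohn : ∀ k i {P} → det P ≈ one → tr P ≈ 𝓜 k ⊗ m₁₂ P ⊖ ⟪ kAt k i ⟫ → IsCohn (𝐌 k) (κ k i) P
  CGC⇒IsCohn k i d t = mkCohn (mk≋ d) (mk≋ t)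

  product−S : ∀ k P Q R → let s = 𝐌 k * m₁₂ R - (m₁₁ R + m₂₂ R) in
    ((P · Q) −ₘ S k R) ≋ₘ mat
      (m₁₁ P * m₁₁ Q + m₁₂ P * m₂₁ Q - s) (m₁₁ P * m₁₂ Q + m₁₂ P * m₂₂ Q - ι 0ℤ)
      (m₂₁ P * m₁₁ Q + m₂₂ P * m₂₁ Q - s * 𝐌 k) (m₂₁ P * m₁₂ Q + m₂₂ P * m₂₂ Q - s)
  product−S k P Q T = ≋ₘ-refl

  Pmat-entries : ∀ k π f → let p₂₂ = (- (f * X (π 1F) * X (π 2F)) + κ k (π 1F) * X (π 0F) * X (π 2F)
                                   + κ k (π 2F) * X (π 0F) * X (π 1F) + X (π 0F) * X (π 0F) + X (π 1F) * X (π 1F)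
                                   + X (π 2F) * X (π 2F)) * Xinv (π 1F) * Xinv (π 2F) in
    Pmat k π f ≋ₘ mat f (X (π 0F)) ((f * p₂₂ - ι 1ℤ) * Xinv (π 0F)) p₂₂
  Pmat-entries k π f = ≋ₘ-refl

  Qmat-entries : ∀ k π f → let q₁₁ = (f * X (π 1F) + κ k (π 0F) * X (π 1F) + X (π 2F)) * Xinv (π 0F)
                               q₂₂ = (- (f * X (π 1F) * X (π 2F)) + κ k (π 2F) * X (π 0F) * X (π 1F)
                                   + X (π 0F) * X (π 0F) + X (π 1F) * X (π 1F)) * Xinv (π 0F) * Xinv (π 2F) in
    Qmat k π f ≋ₘ mat q₁₁ (X (π 1F)) ((q₁₁ * q₂₂ - ι 1ℤ) * Xinv (π 1F)) q₂₂
  Qmat-entries k π f = ≋ₘ-refl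

  Rmat-entries : ∀ k π f → let r₁₁ = (f * X (π 1F) * X (π 2F) + κ k (π 0F) * X (π 1F) * X (π 2F)
                                   + κ k (π 1F) * X (π 0F) * X (π 2F) + X (π 0F) * X (π 0F) + X (π 2F) * X (π 2F))
                                   * Xinv (π 0F) * Xinv (π 1F)
                               r₂₂ = (- (f * X (π 1F) * X (π 2F)) + X (π 1F) * X (π 1F)) * Xinv (π 0F) * Xinv (π 1F) in
    Rmat k π f ≋ₘ mat r₁₁ (X (π 2F)) ((r₁₁ * r₂₂ - ι 1ℤ) * Xinv (π 2F)) r₂₂
  Rmat-entries k π f = ≋ₘ-refl

product-intro : ∀ {k s P Q R Y} → IsCohn (𝐌 k) s R → Y ≋ₘ ((P · Q) −ₘ S k R) → Product (𝐌 k) s P Y Q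
product-intro {k} {s} {P} {Q} {T} {Y} c Y≋ with ≋ₘ-trans Y≋ (product−S k P Q T)
... | mk≋ₘ a b c′ d = mkProduct (≋-trans a (+-cong ≋-refl (neg-cong σ)))
    (≋-trans b (solve 1 (λ x → x :- con 0ℤ := x) ≋-refl _))
    (≋-trans c′ (+-cong ≋-refl (neg-cong (*-cong σ ≋-refl)))) (≋-trans d (+-cong ≋-refl (neg-cong σ)))
  where
  σ : 𝐌 k * m₁₂ T - (m₁₁ T + m₂₂ T) ≋ s
  σ = by-combination (solve 3 (λ t m s → m :- t :- s := con -1ℤ :* (t :- (m :- s))) ≋-refl _ _ _) (ι -1ℤ ·₀ trace c)

-- The initial triple

completed-unimodular : ∀ a d y z → y * z ≋ ι 1ℤ → a * d - y * ((a * d - ι 1ℤ) * z) ≋ ι 1ℤ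
completed-unimodular a d y z h = by-combination (solve 4 (λ a d y z →
    a :* d :- y :* ((a :* d :- con 1ℤ) :* z) :- con 1ℤ := (:- (a :* d :- con 1ℤ)) :* (y :* z :- con 1ℤ)) ≋-refl a d y z)
  ((- (a * d - ι 1ℤ)) ·₀ h)

module RootTraces {M f κ₁ κ₂ κ₃ y₁ y₂ y₃ z₁ z₂ z₃ : LP} (i₁ : y₁ * z₁ ≋ ι 1ℤ) (i₂ : y₂ * z₂ ≋ ι 1ℤ) (i₃ : y₃ * z₃ ≋ ι 1ℤ)
  (m : Markov M κ₁ κ₂ κ₃ y₁ y₂ y₃) where

  traceP : f + (- (f * y₂ * y₃) + κ₂ * y₁ * y₃ + κ₃ * y₁ * y₂ + y₁ * y₁ + y₂ * y₂ + y₃ * y₃) * z₂ * z₃ ≋ M * y₁ - κ₁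
  traceP = by-combination (solve 10 (λ M f κ₁ κ₂ κ₃ y₁ y₂ y₃ z₂ z₃ →
      f :+ ((:- (f :* y₂ :* y₃)) :+ κ₂ :* y₁ :* y₃ :+ κ₃ :* y₁ :* y₂ :+ y₁ :* y₁ :+ y₂ :* y₂ :+ y₃ :* y₃) :* z₂ :* z₃
      :- (M :* y₁ :- κ₁) :=
      (z₂ :* z₃) :* (y₁ :* y₁ :+ y₂ :* y₂ :+ y₃ :* y₃ :+ κ₁ :* y₂ :* y₃ :+ κ₂ :* y₁ :* y₃ :+ κ₃ :* y₁ :* y₂ :- M :* y₁ :* y₂ :* y₃)
      :+ (((M :* y₁ :- κ₁ :- f) :* (y₃ :* z₃)) :* (y₂ :* z₂ :- con 1ℤ) :+ (M :* y₁ :- κ₁ :- f) :* (y₃ :* z₃ :- con 1ℤ)))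
      ≋-refl M f κ₁ κ₂ κ₃ y₁ y₂ y₃ z₂ z₃)
    ((z₂ * z₃) ·₀ equation m ⊹ ((M * y₁ - κ₁ - f) * (y₃ * z₃)) ·₀ i₂ ⊹ (M * y₁ - κ₁ - f) ·₀ i₃)

  traceQ : (f * y₂ + κ₁ * y₂ + y₃) * z₁ + (- (f * y₂ * y₃) + κ₃ * y₁ * y₂ + y₁ * y₁ + y₂ * y₂) * z₁ * z₃ ≋ M * y₂ - κ₂
  traceQ = by-combination (solve 10 (λ M f κ₁ κ₂ κ₃ y₁ y₂ y₃ z₁ z₃ →
      (f :* y₂ :+ κ₁ :* y₂ :+ y₃) :* z₁ :+ ((:- (f :* y₂ :* y₃)) :+ κ₃ :* y₁ :* y₂ :+ y₁ :* y₁ :+ y₂ :* y₂) :* z₁ :* z₃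
      :- (M :* y₂ :- κ₂) :=
      (z₁ :* z₃) :* (y₁ :* y₁ :+ y₂ :* y₂ :+ y₃ :* y₃ :+ κ₁ :* y₂ :* y₃ :+ κ₂ :* y₁ :* y₃ :+ κ₃ :* y₁ :* y₂ :- M :* y₁ :* y₂ :* y₃)
      :+ (((M :* y₂ :- κ₂) :* (y₃ :* z₃)) :* (y₁ :* z₁ :- con 1ℤ)
      :+ (M :* y₂ :- κ₂ :- (f :* y₂ :+ κ₁ :* y₂ :+ y₃) :* z₁) :* (y₃ :* z₃ :- con 1ℤ)))
      ≋-refl M f κ₁ κ₂ κ₃ y₁ y₂ y₃ z₁ z₃)
    ((z₁ * z₃) ·₀ equation m ⊹ ((M * y₂ - κ₂) * (y₃ * z₃)) ·₀ i₁
      ⊹ (M * y₂ - κ₂ - (f * y₂ + κ₁ * y₂ + y₃) * z₁) ·₀ i₃)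

  traceR : (f * y₂ * y₃ + κ₁ * y₂ * y₃ + κ₂ * y₁ * y₃ + y₁ * y₁ + y₃ * y₃) * z₁ * z₂
    + (- (f * y₂ * y₃) + y₂ * y₂) * z₁ * z₂ ≋ M * y₃ - κ₃
  traceR = by-combination (solve 10 (λ M f κ₁ κ₂ κ₃ y₁ y₂ y₃ z₁ z₂ →
      (f :* y₂ :* y₃ :+ κ₁ :* y₂ :* y₃ :+ κ₂ :* y₁ :* y₃ :+ y₁ :* y₁ :+ y₃ :* y₃) :* z₁ :* z₂
      :+ ((:- (f :* y₂ :* y₃)) :+ y₂ :* y₂) :* z₁ :* z₂ :- (M :* y₃ :- κ₃) :=
      (z₁ :* z₂) :* (y₁ :* y₁ :+ y₂ :* y₂ :+ y₃ :* y₃ :+ κ₁ :* y₂ :* y₃ :+ κ₂ :* y₁ :* y₃ :+ κ₃ :* y₁ :* y₂ :- M :* y₁ :* y₂ :* y₃)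
      :+ (((M :* y₃ :- κ₃) :* (y₂ :* z₂)) :* (y₁ :* z₁ :- con 1ℤ) :+ (M :* y₃ :- κ₃) :* (y₂ :* z₂ :- con 1ℤ)))
      ≋-refl M f κ₁ κ₂ κ₃ y₁ y₂ y₃ z₁ z₂)
    ((z₁ * z₂) ·₀ equation m ⊹ ((M * y₃ - κ₃) * (y₂ * z₂)) ·₀ i₁ ⊹ (M * y₃ - κ₃) ·₀ i₂)

  -- The first two summands form the (1,2)-entry of P_τ(f) Q_τ(f). There f cancels, leaving (y₁² +
  -- κ₃ y₁ y₂ + y₂²) / y₃, the other root of the Markov equation in its third unknown.
  new-root-sum : f * y₂ + y₁ * ((- (f * y₂ * y₃) + κ₃ * y₁ * y₂ + y₁ * y₁ + y₂ * y₂) * z₁ * z₃)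
    + y₃ + κ₁ * y₂ + κ₂ * y₁ ≋ M * y₁ * y₂
  new-root-sum = by-combination (solve 10 (λ M f κ₁ κ₂ κ₃ y₁ y₂ y₃ z₁ z₃ →
      f :* y₂ :+ y₁ :* (((:- (f :* y₂ :* y₃)) :+ κ₃ :* y₁ :* y₂ :+ y₁ :* y₁ :+ y₂ :* y₂) :* z₁ :* z₃)
      :+ y₃ :+ κ₁ :* y₂ :+ κ₂ :* y₁ :- M :* y₁ :* y₂ :=
      z₃ :* (y₁ :* y₁ :+ y₂ :* y₂ :+ y₃ :* y₃ :+ κ₁ :* y₂ :* y₃ :+ κ₂ :* y₁ :* y₃ :+ κ₃ :* y₁ :* y₂ :- M :* y₁ :* y₂ :* y₃)
      :+ ((((:- (f :* y₂ :* y₃)) :+ κ₃ :* y₁ :* y₂ :+ y₁ :* y₁ :+ y₂ :* y₂) :* z₃) :* (y₁ :* z₁ :- con 1ℤ)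
      :+ (M :* y₁ :* y₂ :- y₃ :- κ₁ :* y₂ :- κ₂ :* y₁ :- f :* y₂) :* (y₃ :* z₃ :- con 1ℤ)))
      ≋-refl M f κ₁ κ₂ κ₃ y₁ y₂ y₃ z₁ z₃)
    (z₃ ·₀ equation m ⊹ ((- (f * y₂ * y₃) + κ₃ * y₁ * y₂ + y₁ * y₁ + y₂ * y₂) * z₃) ·₀ i₁
      ⊹ (M * y₁ * y₂ - y₃ - κ₁ * y₂ - κ₂ * y₁ - f * y₂) ·₀ i₃)

-- Vertices of the tree and their growth

record TreeVertex (k : K) (kp kq kr : ℕ) (P Q R : M₂) : Set where
  field
    triple : CohnTriple (𝐌 k) (ι (+ kp)) (ι (+ kq)) (ι (+ kr)) P Q R
    0<p : 0ℤ ℤ.< ∣ m₁₂ P ∣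
    0<r : 0ℤ ℤ.< ∣ m₁₂ R ∣
    p<q : ∣ m₁₂ P ∣ ℤ.< ∣ m₁₂ Q ∣
    r<q : ∣ m₁₂ R ∣ ℤ.< ∣ m₁₂ Q ∣
open TreeVertex

TreeVertex-flip : ∀ {k kp kq kr P Q R} → TreeVertex k kp kq kr P Q R → TreeVertex k kr kq kp (flip R) (flip Q) (flip P)
TreeVertex-flip v = record
  { triple = CohnTriple-flip (triple v) ; 0<p = 0<r v ; 0<r = 0<p v ; p<q = r<q v ; r<q = p<q v }

left-vertex : ∀ {k kp kq kr P Q R Y} → TreeVertex k kp kq kr P Q R → Product (𝐌 k) (ι (+ kr)) P Y Q →
  TreeVertex k kp kr kq P Y Q
left-vertex {kr = kr} {P} {Q} v h = record
  { triple = left-triple (triple v) h ; 0<p = 0<p v ; 0<r = ℤP.<-trans (0<r v) (r<q v)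
  ; p<q = ℤP.<-trans (p<q v) grown ; r<q = grown }
  where
  grown = exchange-grows kr (trans (∣exchange∣ kr (child-exchange (triple v) h)) (exchℤ-sym kr ∣ m₁₂ P ∣ ∣ m₁₂ Q ∣))
    (0<r v) (ℤP.<⇒≤ (r<q v)) (0<p v)

right-vertex : ∀ {k kp kq kr P Q R Y} → TreeVertex k kp kq kr P Q R → Product (𝐌 k) (ι (+ kp)) Q Y R →
  TreeVertex k kq kp kr Q Y R
right-vertex v h = TreeVertex-flip (left-vertex (TreeVertex-flip v) (Product-flip h))

module _ (k : K) (σ : S₃) (f : LP) where
  private
    π = τ σ
    m : Markov (𝐌 k) (κ k (π 0F)) (κ k (π 1F)) (κ k (π 2F)) (X (π 0F)) (X (π 1F)) (X (π 2F))
    m = Markov-swap₂₃ (MarkovAt-from-id σ {X} (mkMarkov (𝐌-clear k)))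
    module T = RootTraces {f = f} (X*Xinv (π 0F)) (X*Xinv (π 1F)) (X*Xinv (π 2F)) m
    Y = (Pmat k π f · Qmat k π f) −ₘ S k (Rmat k π f)

  Pmat-cohn : IsCohn (𝐌 k) (κ k (π 0F)) (Pmat k π f)
  Pmat-cohn = IsCohn-cong (≋ₘ-sym (Pmat-entries k π f)) (mkCohn (completed-unimodular _ _ _ _ (X*Xinv (π 0F))) T.traceP)

  Qmat-cohn : IsCohn (𝐌 k) (κ k (π 1F)) (Qmat k π f)
  Qmat-cohn = IsCohn-cong (≋ₘ-sym (Qmat-entries k π f)) (mkCohn (completed-unimodular _ _ _ _ (X*Xinv (π 1F))) T.traceQ)

  Rmat-cohn : IsCohn (𝐌 k) (κ k (π 2F)) (Rmat k π f)
  Rmat-cohn = IsCohn-cong (≋ₘ-sym (Rmat-entries k π f)) (mkCohn (completed-unimodular _ _ _ _ (X*Xinv (π 2F))) T.traceR)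

  root-product-form : Product (𝐌 k) (κ k (π 2F)) (Pmat k π f) Y (Qmat k π f)
  root-product-form = product-intro Rmat-cohn ≋ₘ-refl

  root-new-root-sum : m₁₂ Y + X (π 2F) + κ k (π 0F) * X (π 1F) + κ k (π 1F) * X (π 0F) ≋ 𝐌 k * X (π 0F) * X (π 1F)
  root-new-root-sum = ≋-trans (+-cong (+-cong (+-cong (≋-trans (entry₁₂ root-product-form)
    (+-cong (*-cong (≋₁₁ (Pmat-entries k π f)) ≋-refl) (*-cong ≋-refl (≋₂₂ (Qmat-entries k π f))))) ≋-refl) ≋-refl) ≋-refl)
    T.new-root-sum

  root-vertex : TreeVertex k (kAt k (π 0F)) (kAt k (π 2F)) (kAt k (π 1F)) (Pmat k π f) Y (Qmat k π f)
  root-vertex = record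
    { triple = mkTriple Pmat-cohn (mkCohn (Product-unimodular (unimodular Pmat-cohn) (unimodular Qmat-cohn) root-product-form tQ) tQ)
        Qmat-cohn root-product-form markovY
    ; 0<p = unit (π 0F) ; 0<r = unit (π 1F)
    ; p<q = grown
    ; r<q = subst (ℤ._< ∣ m₁₂ Y ∣) (trans (∣∣-X (π 0F)) (sym (∣∣-X (π 1F)))) grown }
    where
    unit : ∀ i → 0ℤ ℤ.< ∣ X i ∣
    unit i = subst (0ℤ ℤ.<_) (sym (∣∣-X i)) (ℤ.+<+ (ℕ.s≤s ℕ.z≤n))
    markovY : Markov (𝐌 k) (κ k (π 0F)) (κ k (π 2F)) (κ k (π 1F)) (X (π 0F)) (m₁₂ Y) (X (π 1F))
    markovY = Markov-vieta (Markov-swap₂₃ m) root-new-root-sum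
    tQ : m₁₁ Y + m₂₂ Y ≋ 𝐌 k * m₁₂ Y - κ k (π 2F)
    tQ = Product-trace (0<∣∣⇒nonzero (subst (0ℤ ℤ.<_) (sym (∣∣-* (X (π 0F)) (X (π 1F)))) (0<* (unit (π 0F)) (unit (π 1F)))))
      Pmat-cohn Qmat-cohn root-product-form markovY
    -- The comparison required by `exchange-grows` holds with equality, all initial values being 1.
    grown : ∣ X (π 0F) ∣ ℤ.< ∣ m₁₂ Y ∣
    grown = exchange-grows (kAt k (π 2F)) (∣exchange∣ (kAt k (π 2F)) (root-product (Markov-swap₂₃ m) root-new-root-sum))
      (unit (π 2F)) (ℤP.≤-reflexive (trans (∣∣-X (π 2F)) (sym (∣∣-X (π 0F))))) (unit (π 1F))

record _≋ₜ_ (t u : MTriple) : Set where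
  constructor mk≋ₜ
  field
    ≋P : proj₁ t ≋ₘ proj₁ u
    ≋Q : proj₁ (proj₂ t) ≋ₘ proj₁ (proj₂ u)
    ≋R : proj₂ (proj₂ t) ≋ₘ proj₂ (proj₂ u)
open _≋ₜ_

child : K → Dir → MTriple → MTriple
child k L = leftChild k
child k R = rightChild k

-- Paths read from the vertex up to the root.
climb : K → MTriple → List Dir → MTriple
climb k = foldr (child k)

walk≡climb : ∀ k t ds → walk k t ds ≡ climb k t (reverse ds)
walk≡climb k t ds = trans (walk≡foldl t ds) (sym (reverse-foldr (child k) t ds))
  where
  walk≡foldl : ∀ t ds → walk k t ds ≡ foldl (λ u d → child k d u) t ds
  walk≡foldl t [] = refl
  walk≡foldl t (L ∷ ds) = walk≡foldl _ ds
  walk≡foldl t (R ∷ ds) = walk≡foldl _ ds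

record IsTreeVertex (k : K) (t : MTriple) : Set where
  constructor isTreeVertex
  field
    {kp kq kr} : ℕ
    holds : TreeVertex k kp kq kr (proj₁ t) (proj₁ (proj₂ t)) (proj₂ (proj₂ t))
open IsTreeVertex

child-vertex : ∀ {k} d t → IsTreeVertex k t → IsTreeVertex k (child k d t)
child-vertex L (P , Q , T) (isTreeVertex v) =
  isTreeVertex (left-vertex v (product-intro {P = P} {Q} {T} (cohnR (triple v)) ≋ₘ-refl))
child-vertex R (P , Q , T) (isTreeVertex v) =
  isTreeVertex (right-vertex v (product-intro {P = Q} {T} {P} (cohnP (triple v)) ≋ₘ-refl))

climb-vertex : ∀ {k t} r → IsTreeVertex k t → IsTreeVertex k (climb k t r)
climb-vertex [] v = v
climb-vertex (d ∷ r) v = child-vertex d _ (climb-vertex r v)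

root-isTreeVertex : ∀ k σ f → IsTreeVertex k (root k σ f)
root-isTreeVertex k σ f = isTreeVertex (root-vertex k σ f)

-- Uniqueness

-- The trace condition reads s off the matrix. Two tree vertices under comparison come with
-- unrelated hidden parities, which must be identified before their quotients can be.
IsCohn-parameter : ∀ {M s s′ P P′} → IsCohn M s P → IsCohn M s′ P′ → P ≋ₘ P′ → s ≋ s′
IsCohn-parameter {M} {s} {s′} {mat a b c d} {mat a′ b′ c′ d′} (mkCohn _ t) (mkCohn _ t′) (mk≋ₘ aa bb _ dd) =
  by-combination (solve 9 (λ M s s′ a b d a′ b′ d′ → s :- s′ :=
      con 1ℤ :* (a :+ d :- (M :* b :- s)) :+ (con -1ℤ :* (a′ :+ d′ :- (M :* b′ :- s′))
      :+ (con -1ℤ :* (a :- a′) :+ (con -1ℤ :* (d :- d′) :+ M :* (b :- b′))))) ≋-refl M s s′ a b d a′ b′ d′)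
    (ι 1ℤ ·₀ t ⊹ ι -1ℤ ·₀ t′ ⊹ ι -1ℤ ·₀ aa ⊹ ι -1ℤ ·₀ dd ⊹ M ·₀ bb)

CohnTriple-determines-R : ∀ {M κp κq κr κp′ κq′ κr′ P Q T P′ Q′ T′} →
  CohnTriple M κp κq κr P Q T → CohnTriple M κp′ κq′ κr′ P′ Q′ T′ → P ≋ₘ P′ → Q ≋ₘ Q′ → T ≋ₘ T′
CohnTriple-determines-R t t′ pp qq = ≋ₘ-trans (quotient-unique (unimodular (cohnP t)) (product t))
  (≋ₘ-trans (quotient-cong (IsCohn-parameter (cohnQ t) (cohnQ t′) qq) pp qq)
    (≋ₘ-sym (quotient-unique (unimodular (cohnP t′)) (product t′))))

CohnTriple-determines-P : ∀ {M κp κq κr κp′ κq′ κr′ P Q T P′ Q′ T′} →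
  CohnTriple M κp κq κr P Q T → CohnTriple M κp′ κq′ κr′ P′ Q′ T′ → Q ≋ₘ Q′ → T ≋ₘ T′ → P ≋ₘ P′
CohnTriple-determines-P t t′ qq rr =
  flip-≋ (CohnTriple-determines-R (CohnTriple-flip t) (CohnTriple-flip t′) (flip-≋ rr) (flip-≋ qq))

X-injective : ∀ {i j} → X i ≋ X j → i ≡ j
X-injective {i} {j} h = HasParity-unique (HasParity-cong h (HasParity-X i)) (HasParity-X j)

S₃-determined : ∀ σ σ′ → apply σ 0F ≡ apply σ′ 0F → apply σ 2F ≡ apply σ′ 2F → σ ≡ σ′
S₃-determined σ σ′ h₀ h₂ = trans (sym (decode-apply σ)) (trans (cong₂ decode h₀ h₂) (decode-apply σ′))
  where
  decode : Fin 3 → Fin 3 → S₃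
  decode 0F 2F = id
  decode 0F _ = t23
  decode 1F 2F = t12
  decode 1F _ = c123
  decode 2F 0F = t13
  decode 2F _ = c132
  decode-apply : ∀ σ → decode (apply σ 0F) (apply σ 2F) ≡ σ
  decode-apply id = refl
  decode-apply t12 = refl
  decode-apply t13 = refl
  decode-apply t23 = refl
  decode-apply c123 = refl
  decode-apply c132 = refl

valueP valueR : MTriple → ℤ
valueP t = ∣ m₁₂ (proj₁ t) ∣
valueR t = ∣ m₁₂ (proj₂ (proj₂ t)) ∣

root-balanced : ∀ k σ f → valueP (root k σ f) ≡ valueR (root k σ f)
root-balanced k σ f = trans (∣∣-X (apply σ 0F)) (sym (∣∣-X (apply σ 2F)))

left-unbalanced : ∀ {k} t → IsTreeVertex k t → valueP (leftChild k t) < valueR (leftChild k t)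
left-unbalanced t v = p<q (holds v)

right-unbalanced : ∀ {k} t → IsTreeVertex k t → valueR (rightChild k t) < valueP (rightChild k t)
right-unbalanced t v = r<q (holds v)

≋ₜ-valueP : ∀ {t u} → t ≋ₜ u → valueP t ≡ valueP u
≋ₜ-valueP h = ∣∣-cong (≋₁₂ (≋P h))

≋ₜ-valueR : ∀ {t u} → t ≋ₜ u → valueR t ≡ valueR u
≋ₜ-valueR h = ∣∣-cong (≋₁₂ (≋R h))

≋ₜ-sym : ∀ {t u} → t ≋ₜ u → u ≋ₜ t
≋ₜ-sym (mk≋ₜ a b c) = mk≋ₜ (≋ₘ-sym a) (≋ₘ-sym b) (≋ₘ-sym c)

≋ₜ-trans : ∀ {t u w} → t ≋ₜ u → u ≋ₜ w → t ≋ₜ w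
≋ₜ-trans (mk≋ₜ a b c) (mk≋ₜ a′ b′ c′) = mk≋ₜ (≋ₘ-trans a a′) (≋ₘ-trans b b′) (≋ₘ-trans c c′)

left-injective : ∀ {k t u} → IsTreeVertex k t → IsTreeVertex k u → leftChild k t ≋ₜ leftChild k u → t ≋ₜ u
left-injective v v′ (mk≋ₜ p _ q) = mk≋ₜ p q (CohnTriple-determines-R (triple (holds v)) (triple (holds v′)) p q)

right-injective : ∀ {k t u} → IsTreeVertex k t → IsTreeVertex k u → rightChild k t ≋ₜ rightChild k u → t ≋ₜ u
right-injective v v′ (mk≋ₜ q _ r) = mk≋ₜ (CohnTriple-determines-P (triple (holds v)) (triple (holds v′)) q r) q r

-- The last step is left, right or absent according as |p₁₂| is <, > or = |r₁₂|.
module _ {k : K} {t u : MTriple} (vt : IsTreeVertex k t) (vu : IsTreeVertex k u)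
  (bt : valueP t ≡ valueR t) (bu : valueP u ≡ valueR u) where

  climb-injective : ∀ r r′ → climb k t r ≋ₜ climb k u r′ → t ≋ₜ u × r ≡ r′
  climb-injective [] [] h = h , refl
  climb-injective [] (L ∷ r′) h = ⊥-elim (ℤP.<-irrefl
    (trans (sym (≋ₜ-valueP h)) (trans bt (≋ₜ-valueR h))) (left-unbalanced _ (climb-vertex r′ vu)))
  climb-injective [] (R ∷ r′) h = ⊥-elim (ℤP.<-irrefl
    (trans (sym (≋ₜ-valueR h)) (trans (sym bt) (≋ₜ-valueP h))) (right-unbalanced _ (climb-vertex r′ vu)))
  climb-injective (L ∷ r) [] h = ⊥-elim (ℤP.<-irrefl
    (trans (≋ₜ-valueP h) (trans bu (sym (≋ₜ-valueR h)))) (left-unbalanced _ (climb-vertex r vt)))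
  climb-injective (R ∷ r) [] h = ⊥-elim (ℤP.<-irrefl
    (trans (≋ₜ-valueR h) (trans (sym bu) (sym (≋ₜ-valueP h)))) (right-unbalanced _ (climb-vertex r vt)))
  climb-injective (L ∷ r) (R ∷ r′) h = ⊥-elim (ℤP.<-asym
    (subst₂ _<_ (≋ₜ-valueP h) (≋ₜ-valueR h) (left-unbalanced _ (climb-vertex r vt))) (right-unbalanced _ (climb-vertex r′ vu)))
  climb-injective (R ∷ r) (L ∷ r′) h = ⊥-elim (ℤP.<-asym
    (subst₂ _<_ (≋ₜ-valueR h) (≋ₜ-valueP h) (right-unbalanced _ (climb-vertex r vt))) (left-unbalanced _ (climb-vertex r′ vu)))
  climb-injective (L ∷ r) (L ∷ r′) h =
    map₂ (cong (L ∷_)) (climb-injective r r′ (left-injective (climb-vertex r vt) (climb-vertex r′ vu) h))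
  climb-injective (R ∷ r) (R ∷ r′) h =
    map₂ (cong (R ∷_)) (climb-injective r r′ (right-injective (climb-vertex r vt) (climb-vertex r′ vu) h))

root-injective : ∀ k σ σ′ f f′ → root k σ f ≋ₜ root k σ′ f′ → f ≋ f′ × σ ≡ σ′
root-injective k σ σ′ f f′ (mk≋ₜ p _ r) =
  ≋₁₁ p , S₃-determined σ σ′ (X-injective (≋₁₂ p)) (X-injective (≋₁₂ r))

-- Existence

-- Indexed by the positions themselves: matching on `arranged ρ` replaces them by values of ρ
-- without equations to transport along.
data Arrangement : Fin 3 → Fin 3 → Fin 3 → Set where
  arranged : ∀ ρ → Arrangement (apply ρ 0F) (apply ρ 1F) (apply ρ 2F)

Arrangement-swap₂₃ : ∀ {i j m} → Arrangement i j m → Arrangement i m j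
Arrangement-swap₂₃ (arranged id) = arranged t23
Arrangement-swap₂₃ (arranged t12) = arranged c123
Arrangement-swap₂₃ (arranged t13) = arranged c132
Arrangement-swap₂₃ (arranged t23) = arranged id
Arrangement-swap₂₃ (arranged c123) = arranged t12
Arrangement-swap₂₃ (arranged c132) = arranged t13

Arrangement-swap₁₂ : ∀ {i j m} → Arrangement i j m → Arrangement j i m
Arrangement-swap₁₂ (arranged id) = arranged t12
Arrangement-swap₁₂ (arranged t12) = arranged id
Arrangement-swap₁₂ (arranged t13) = arranged c123
Arrangement-swap₁₂ (arranged t23) = arranged c132
Arrangement-swap₁₂ (arranged c123) = arranged t13
Arrangement-swap₁₂ (arranged c132) = arranged t23

-- The matrix P comes from its first row, the (1,2)-entry of the product then gives t₂₂ after
-- cancelling p₁₂, and the reflected form of `IsCohn-determined` recovers T from t₁₂ and t₂₂.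
CohnTriple-determined : ∀ {M κp κq κr P Q T P′ Q′ T′} → ¬ m₁₂ P ≋ ι 0ℤ → ¬ m₁₂ T ≋ ι 0ℤ →
  CohnTriple M κp κq κr P Q T → CohnTriple M κp κq κr P′ Q′ T′ →
  m₁₁ P ≋ m₁₁ P′ → m₁₂ P ≋ m₁₂ P′ → m₁₂ Q ≋ m₁₂ Q′ → m₁₂ T ≋ m₁₂ T′ → (P , Q , T) ≋ₜ (P′ , Q′ , T′)
CohnTriple-determined {P = P} {Q} {T} {P′} {Q′} {T′} p≢0 t≢0 t t′ aa pp qq rr =
  mk≋ₜ PP (Product-unique PP TT (product t) (product t′)) TT
  where
  PP : P ≋ₘ P′
  PP = IsCohn-determined p≢0 (cohnP t) (cohnP t′) aa pp
  dd : m₂₂ T ≋ m₂₂ T′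
  dd = *-cancelʳ (m₁₂ P) p≢0 (by-combination
    (solve 10 (λ p₁ p₂ q t d p₁′ p₂′ q′ t′ d′ → d :* p₂ :- d′ :* p₂ :=
      con -1ℤ :* (q :- (p₁ :* t :+ p₂ :* d)) :+ (con 1ℤ :* (q′ :- (p₁′ :* t′ :+ p₂′ :* d′))
      :+ (con 1ℤ :* (q :- q′) :+ ((:- t) :* (p₁ :- p₁′) :+ ((:- p₁′) :* (t :- t′) :+ (:- d′) :* (p₂ :- p₂′))))))
      ≋-refl (m₁₁ P) (m₁₂ P) (m₁₂ Q) (m₁₂ T) (m₂₂ T) (m₁₁ P′) (m₁₂ P′) (m₁₂ Q′) (m₁₂ T′) (m₂₂ T′))
    (ι -1ℤ ·₀ entry₁₂ (product t) ⊹ ι 1ℤ ·₀ entry₁₂ (product t′) ⊹ ι 1ℤ ·₀ qq ⊹ (- m₁₂ T) ·₀ aa ⊹ (- m₁₁ P′) ·₀ rr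
      ⊹ (- m₂₂ T′) ·₀ pp))
  TT : T ≋ₘ T′
  TT = flip-≋ (IsCohn-determined t≢0 (IsCohn-flip (cohnR t)) (IsCohn-flip (cohnR t′)) dd rr)

Occurs : K → MTriple → Set
Occurs k t = Σ LP λ f → Σ S₃ λ σ → Σ (List Dir) λ r → climb k (root k σ f) r ≋ₜ t

module _ {k : K} {i j m : Fin 3} {P Q T : M₂} (t : CohnTriple (𝐌 k) (κ k i) (κ k j) (κ k m) P Q T) where

  -- The tree subtracts `S` of the third matrix of the parent. By `left-parent-cohn` that matrix has
  -- the parity of Q, so the subtracted term is the one in the product relation for Q.
  left-occurs : Occurs k (P , T , quotient (𝐌 k) (κ k m) P T) → Occurs k (P , Q , T)
  left-occurs (f , σ , r , h) = f , σ , L ∷ r , mk≋ₜ (≋P h)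
    (Product-unique (≋P h) (≋Q h) (product-intro (IsCohn-cong (≋ₘ-sym (≋R h)) (left-parent-cohn t)) ≋ₘ-refl) (product t))
    (≋Q h)

  right-occurs : Occurs k (flip (quotient (𝐌 k) (κ k i) (flip T) (flip P)) , P , T) → Occurs k (P , Q , T)
  right-occurs (f , σ , r , h) = f , σ , R ∷ r , mk≋ₜ (≋Q h)
    (Product-unique (≋Q h) (≋R h)
      (product-intro (IsCohn-cong (≋ₘ-sym (≋P h)) (IsCohn-flip (left-parent-cohn (CohnTriple-flip t)))) ≋ₘ-refl) (product t))
    (≋R h)

root-occurs : ∀ {k P Q T} ρ → CohnTriple (𝐌 k) (κ k (apply ρ 0F)) (κ k (apply ρ 1F)) (κ k (apply ρ 2F)) P Q T →
  m₁₂ P ≋ X (apply ρ 0F) → m₁₂ T ≋ X (apply ρ 2F) →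
  m₁₂ (quotient (𝐌 k) (κ k (apply ρ 2F)) P T) ≋ X (apply ρ 1F) → Occurs k (P , Q , T)
root-occurs {k} {P} {Q} {T} ρ t pp rr yy = m₁₁ P , ρ , [] , ≋ₜ-sym
  (CohnTriple-determined (nonzero pp) (nonzero rr) t (triple (root-vertex k ρ (m₁₁ P))) ≋-refl pp qq rr)
  where
  nonzero : ∀ {p i} → p ≋ X i → ¬ p ≋ ι 0ℤ
  nonzero {i = i} h = 0<∣∣⇒nonzero (subst (0ℤ <_) (sym (trans (∣∣-cong h) (∣∣-X i))) (ℤ.+<+ (ℕ.s≤s ℕ.z≤n)))
  κ₀ = κ k (apply ρ 0F)
  κ₂ = κ k (apply ρ 2F)
  x₀ = X (apply ρ 0F)
  x = X (apply ρ 1F)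
  x₂′ = X (apply ρ 2F)
  b = m₁₂ (proj₁ (proj₂ (root k ρ (m₁₁ P))))
  sum : x + m₁₂ Q + κ₀ * x₂′ + κ₂ * x₀ ≋ 𝐌 k * x₀ * x₂′
  sum = ≋-trans (≋-sym (+-cong (+-cong (+-cong yy ≋-refl) (*-cong ≋-refl rr)) (*-cong ≋-refl pp)))
    (≋-trans (left-parent-root-sum t) (*-cong (*-cong ≋-refl pp) rr))
  -- Both middle entries complete x to the same root sum, so they agree.
  qq : m₁₂ Q ≋ b
  qq = by-combination (solve 6 (λ q b x u v w → q :- b :=
      con 1ℤ :* (x :+ q :+ u :+ v :- w) :+ con -1ℤ :* (b :+ x :+ u :+ v :- w)) ≋-refl
      (m₁₂ Q) b x (κ₀ * x₂′) (κ₂ * x₀) (𝐌 k * x₀ * x₂′))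
    (ι 1ℤ ·₀ sum ⊹ ι -1ℤ ·₀ root-new-root-sum k ρ (m₁₁ P))

-- Recursion along the path of the cluster: the matrices of the parent are quotients, and its
-- cluster is identified with `l′` because both arise by the same exchange.
descent-occurs : ∀ {k l i j m P Q T} → Descent k l → Positive l → Arrangement i j m →
  CohnTriple (𝐌 k) (κ k i) (κ k j) (κ k m) P Q T →
  m₁₂ P ≋ l i → m₁₂ Q ≋ l j → m₁₂ T ≋ l m → StrictMax j l → Occurs k (P , Q , T)
descent-occurs (done e) pos (arranged ρ) t pp qq rr smax =
  ⊥-elim (ℤP.<-irrefl (trans (unit (apply ρ 0F)) (sym (unit (apply ρ 1F)))) (smax (apply ρ 0F) (apply-≢₀₁ ρ)))
  where
  unit : ∀ i → _ ≡ 1ℤ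
  unit i = trans (sym (∣∣-cong (e i))) (∣∣-X i)
descent-occurs {k} {l} {j = j} {P = P} {Q} {T} (down {l′ = l′} j′ peak peak≢ big mx mu d) pos (arranged ρ) t pp qq rr smax
  with j′ ≟ j
-- The position exchanged by the path and the middle position both carry a strict maximum, hence
-- coincide.
... | no j′≢j = ⊥-elim (ℤP.<-asym (mx j (λ j≡j′ → j′≢j (sym j≡j′))) (smax j′ j′≢j))
... | yes refl = parent d
  where
  back : Mutation k j l l′
  back = Mutation-sym mu
  pos′ : Positive l′
  pos′ = mutation-positive back pos
  pp′ : m₁₂ P ≋ l′ (apply ρ 0F)
  pp′ = ≋-trans pp (off back _ (apply-≢₀₁ ρ))
  rr′ : m₁₂ T ≋ l′ (apply ρ 2F)
  rr′ = ≋-trans rr (off back _ (apply-≢₂₁ ρ))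
  mutated : ∀ {y} → y * m₁₂ Q ≋ exchLP (kAt k j) (m₁₂ P) (m₁₂ T) → y ≋ l′ j
  mutated h = *-cancelʳ (l j) (0<∣∣⇒nonzero (pos j)) (≋-trans (*-cong ≋-refl (≋-sym qq)) (≋-trans h
    (≋-trans (exchLP-cong (kAt k j) pp rr) (≋-trans (≋-sym (exchange-apply k l ρ)) (≋-sym (on back))))))
  yy : m₁₂ (quotient (𝐌 k) (κ k (apply ρ 2F)) P T) ≋ l′ j
  yy = mutated (left-parent-exchange t)
  parent : Descent k l′ → Occurs k (P , Q , T)
  parent (done e) = root-occurs ρ t (≋-trans pp′ (≋-sym (e _))) (≋-trans rr′ (≋-sym (e _))) (≋-trans yy (≋-sym (e _)))
  parent (down n _ _ _ mx′ _ _) with n ≟ j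
  -- The path is reduced: after the exchange at j, position `peak` holds a maximum, so the next
  -- strict maximum cannot lie at j. It lies at T for a left child and at P for a right child.
  ... | yes refl = ⊥-elim (ℤP.<⇒≱ (mx′ peak peak≢) (big j))
  ... | no n≢j with apply-cover ρ n n≢j
  ...   | inj₂ refl = left-occurs {k} {apply ρ 0F} {j} {n} t
    (descent-occurs d pos′ (Arrangement-swap₂₃ (arranged ρ)) (left-parent t) pp′ rr′ yy mx′)
  -- The right parent is the left parent of the reflected triple, reflected back; reflection
  -- interchanges the outer entries, hence `exchLP-sym`.
  ...   | inj₁ refl = right-occurs {k} {n} {j} {apply ρ 2F} t
    (descent-occurs d pos′ (Arrangement-swap₁₂ (arranged ρ)) (CohnTriple-flip (left-parent (CohnTriple-flip t)))
      (mutated (≋-trans (left-parent-exchange (CohnTriple-flip t)) (exchLP-sym (kAt k j) (m₁₂ T) (m₁₂ P)))) pp′ rr′ mx′)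

-- Translation to the stated notions and conclusion

opaque
  unfolding ∣_∣

  ∣∣ₗ≡∣∣ : ∀ p → ∣ p ∣ₗ ≡ ∣ p ∣
  ∣∣ₗ≡∣∣ p = refl

get-permute : ∀ σ t i → get (permute σ t) i ≡ get t (apply σ i)
get-permute σ t 0F = refl
get-permute σ t 1F = refl
get-permute σ t 2F = refl

to-≈ₜ : ∀ t u → t ≋ₜ u → t ≈ₜ u
to-≈ₜ _ _ (mk≋ₜ p q r) = to-≈ₘ p , to-≈ₘ q , to-≈ₘ r
  where
  to-≈ₘ : ∀ {P Q} → P ≋ₘ Q → P ≈ₘ Q
  to-≈ₘ (mk≋ₘ a b c d) = at a , at b , at c , at d

from-≈ₘ : ∀ P Q → P ≈ₘ Q → P ≋ₘ Q
from-≈ₘ _ _ (a , b , c , d) = mk≋ₘ (mk≋ a) (mk≋ b) (mk≋ c) (mk≋ d)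

from-≈ₜ : ∀ t u → t ≈ₜ u → t ≋ₜ u
from-≈ₜ _ _ (p , q , r) = mk≋ₜ (from-≈ₘ _ _ p) (from-≈ₘ _ _ q) (from-≈ₘ _ _ r)

-- A CGC matrix names only some position at which p₁₂ occurs in some cluster. Uniqueness of parity
-- identifies it with the position in the cluster at hand, so the trace involves the parity needed
-- there.
CGC-cohn : ∀ {k l P} i → IsCluster k l → l i ≋ m₁₂ P → IsCGCMatrix k P → IsCohn (𝐌 k) (κ k i) P
CGC-cohn {k} {P = P} i c h (d , i′ , (s , lab , h′) , t) = CGC⇒IsCohn k i d
  (subst (λ n → tr P ≈ 𝓜 k ⊗ m₁₂ P ⊖ ⟪ kAt k n ⟫) (HasParity-unique
    (HasParity-cong (mk≋ h′) (parity (labeled⇒cluster lab) i′)) (HasParity-cong h (parity c i))) t)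

CGC-occurs : ∀ {k P Q T} → IsCGCTriple k (P , Q , T) → ∣ m₁₂ P ∣ₗ ⊔ ∣ m₁₂ T ∣ₗ < ∣ m₁₂ Q ∣ₗ → Occurs k (P , Q , T)
CGC-occurs {k} {P} {Q} {T} (cp , cq , cr , pr , σ , lab) bound =
  descent-occurs (descent c) (positive c) (arranged ρ) (mkTriple cohnp cohnq cohnr (product-intro cohnq (from-≈ₘ Q _ pr))
    (Markov-cong (entry 0F) (entry 1F) (entry 2F) (MarkovAt-from-id ρ {l} (markov c))))
    (≋-sym (entry 0F)) (≋-sym (entry 1F)) (≋-sym (entry 2F)) smax
  where
  t = m₁₂ P , m₁₂ Q , m₁₂ T
  l = get (permute σ t)
  -- Entry i of t stands at position `apply (inverse σ) i` of the labelled cluster `permute σ t`.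
  ρ = inverse σ
  c : IsCluster k l
  c = labeled⇒cluster lab
  entry : ∀ i → l (apply ρ i) ≋ get t i
  entry i = subst (l (apply ρ i) ≋_) (trans (get-permute σ t (apply ρ i)) (cong (get t) (apply-inverse σ i))) ≋-refl
  cohnp = CGC-cohn (apply ρ 0F) c (entry 0F) cp
  cohnq = CGC-cohn (apply ρ 1F) c (entry 1F) cq
  cohnr = CGC-cohn (apply ρ 2F) c (entry 2F) cr
  smaller : ∀ i → ∣ get t i ∣ₗ ℤ.≤ ∣ m₁₂ P ∣ₗ ⊔ ∣ m₁₂ T ∣ₗ → ∣ l (apply ρ i) ∣ < ∣ l (apply ρ 1F) ∣
  smaller i le = subst₂ _<_ (trans (∣∣ₗ≡∣∣ (get t i)) (sym (∣∣-cong (entry i))))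
    (trans (∣∣ₗ≡∣∣ (m₁₂ Q)) (sym (∣∣-cong (entry 1F)))) (ℤP.≤-<-trans le bound)
  smax : StrictMax (apply ρ 1F) l
  smax n n≢ with apply-cover ρ n n≢
  ... | inj₁ refl = smaller 0F (ℤP.i≤i⊔j ∣ m₁₂ P ∣ₗ ∣ m₁₂ T ∣ₗ)
  ... | inj₂ refl = smaller 2F (ℤP.i≤j⊔i ∣ m₁₂ P ∣ₗ ∣ m₁₂ T ∣ₗ)

climb-reverse : ∀ k σ f r → vertex k σ f (reverse r) ≡ climb k (root k σ f) r
climb-reverse k σ f r = trans (walk≡climb k (root k σ f) (reverse r)) (cong (climb k (root k σ f)) (reverse-involutive r))

climb-root-injective : ∀ k σ σ′ f f′ r r′ → climb k (root k σ f) r ≋ₜ climb k (root k σ′ f′) r′ →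
  f ≋ f′ × σ ≡ σ′ × r ≡ r′
climb-root-injective k σ σ′ f f′ r r′ h = proj₁ same-root , proj₂ same-root , proj₂ same-path
  where
  same-path = climb-injective (root-isTreeVertex k σ f) (root-isTreeVertex k σ′ f′)
    (root-balanced k σ f) (root-balanced k σ′ f′) r r′ h
  same-root = root-injective k σ σ′ f f′ (proj₁ same-path)

UniqueVertex : K → MTriple → Set
UniqueVertex k t = Σ LP λ f → Σ S₃ λ σ → Σ (List Dir) λ v →
  (vertex k σ f v ≈ₜ t) × (∀ f′ σ′ v′ → vertex k σ′ f′ v′ ≈ₜ t → (f′ ≈ f) × (σ′ ≡ σ) × (v′ ≡ v))

occurs-unique : ∀ k t → Occurs k t → UniqueVertex k t
occurs-unique k t (f , σ , r , h) =
  f , σ , reverse r , to-≈ₜ (vertex k σ f (reverse r)) t (subst (_≋ₜ t) (sym (climb-reverse k σ f r)) h) , unique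
  where
  unique : ∀ f′ σ′ v′ → vertex k σ′ f′ v′ ≈ₜ t → (f′ ≈ f) × (σ′ ≡ σ) × (v′ ≡ reverse r)
  unique f′ σ′ v′ h′ = at (proj₁ eqs) , proj₁ (proj₂ eqs) ,
    trans (sym (reverse-involutive v′)) (cong reverse (proj₂ (proj₂ eqs)))
    where
    eqs : f′ ≋ f × σ′ ≡ σ × reverse v′ ≡ r
    eqs = climb-root-injective k σ′ σ f′ f (reverse v′) r
      (≋ₜ-trans (subst (_≋ₜ t) (walk≡climb k (root k σ′ f′) v′) (from-≈ₜ (vertex k σ′ f′ v′) t h′)) (≋ₜ-sym h))

theorem4p13 : (k₁ k₂ k₃ : ℕ) (P Q R : M₂) →
    IsCGCTriple (k₁ , k₂ , k₃) (P , Q , R) →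
    (∣ m₁₂ P ∣ₗ ⊔ ∣ m₁₂ R ∣ₗ) < ∣ m₁₂ Q ∣ₗ →
    Σ LP λ f → Σ S₃ λ σ → Σ (List Dir) λ v →
    (vertex (k₁ , k₂ , k₃) σ f v ≈ₜ (P , Q , R)) ×
    (∀ f′ σ′ v′ → vertex (k₁ , k₂ , k₃) σ′ f′ v′ ≈ₜ (P , Q , R) →
    (f′ ≈ f) × (σ′ ≡ σ) × (v′ ≡ v))
theorem4p13 k₁ k₂ k₃ P Q T cgc bound = occurs-unique (k₁ , k₂ , k₃) (P , Q , T) (CGC-occurs cgc bound)
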